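{- Let $\mathcal{H}\subset\mathcal{O}$ be a family of Hoffman graphs with $\mathfrak{h}_2\in\mathcal{H}$, and let $N\geq 7$ be an integer. If every connected slim $\mathcal{H}$-line graph of order $N$ has exactly one strict $\bar{\mathcal{H}}$-cover up to equivalence, then every connected slim $\mathcal{H}$-line graph of order at least $N$ has exactly one strict $\bar{\mathcal{H}}$-cover up to equivalence.
   Context: All graphs are finite, simple and undirected. A Hoffman graph $\mathfrak{h}=(H,\mu)$ is a graph $H$ with a labeling $\mu:V(H)\to\{f,s\}$ such that every vertex labeled $f$ (a fat vertex) is adjacent to at least one vertex labeled $s$ (a slim vertex), and fat vertices are pairwise non-adjacent. $V_s(\mathfrak{h})$, $V_f(\mathfrak{h})$ denote the sets of slim and fat vertices, and $N^f_{\mathfrak{h}}(x)$ the set of fat neighbours of $x$; $x\sim y$ means adjacency. A Hoffman subgraph is an induced subgraph with the restricted labeling. An ordinary graph is regarded as a Hoffman graph with no fat vertices (a slim graph); the order of a slim graph is its number of vertices. $\mathfrak{h}$ is fat if every slim vertex has a fat neighbour. Isomorphisms of Hoffman graphs are graph isomorphisms preserving labels; membership of a Hoffman graph in a family is meant up to isomorphism. Sum: for Hoffman subgraphs $\mathfrak{h}^1,\dots,\mathfrak{h}^k$ of $\mathfrak{h}$ we write $\mathfrak{h}=\bigoplus_i\mathfrak{h}^i$ if (i) $V(\mathfrak{h})=\bigcup_i V(\mathfrak{h}^i)$; (ii) $V_s(\mathfrak{h})$ is the disjoint union of the $V_s(\mathfrak{h}^i)$; (iii) $N^f_{\mathfrak{h}^i}(x)=N^f_{\mathfrak{h}}(x)$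 for every $x\in V_s(\mathfrak{h}^i)$; (iv) for $x\in V_s(\mathfrak{h}^i)$, $y\in V_s(\mathfrak{h}^j)$, $i\neq j$: $|N^f_{\mathfrak{h}}(x)\cap N^f_{\mathfrak{h}}(y)|\le 1$, with equality iff $x\sim y$. $\mathfrak{h}$ is decomposable if it is the sum of two non-empty Hoffman subgraphs, otherwise indecomposable. $\mathfrak{h}_2$ is the Hoffman graph with one slim vertex adjacent to two fat vertices. $\mathcal{O}$ is the family consisting of $\mathfrak{h}_2$ and all indecomposable fat Hoffman graphs with at least two slim vertices and exactly one fat vertex. For $\mathcal{H}\subset\mathcal{O}$, $\bar{\mathcal{H}}=\{\mathfrak{h}_2\}\cup\{\mathfrak{h}\in\mathcal{O}:\mathfrak{h}\text{ is a Hoffman subgraph of an element of }\mathcal{H}\}$. A Hoffman graph $\mathfrak{g}$ is an $\mathcal{H}$-line Hoffman graph if it is a Hoffman subgraph of some $\mathfrak{h}=\bigoplus_i\mathfrak{h}^i$ with all $\mathfrak{h}^i\in\mathcal{H}$; such $\mathfrak{h}$ is an $\mathcal{H}$-cover of $\mathfrak{g}$, strict if $V_s(\mathfrak{h})=V_s(\mathfrak{g})$. A slim $\mathcal{H}$-line graph is an $\mathcal{H}$-line Hoffman graph with no fat vertices. Two strict $\mathcal{H}$-covers $\mathfrak{h},\mathfrak{h}'$ of $\mathfrak{g}$ are equivalent if there is an isomorphism $\varphi:\mathfrak{h}\to\mathfrak{h}'$ whose restriction to $V(\mathfrak{g})$ is the identity. -}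

module Defs where

open import Data.Nat using (ℕ; zero; suc; _+_; _≤_)
open import Data.Bool using (Bool; true; false; if_then_else_; _∧_)
open import Data.Fin using (Fin; zero; suc)
open import Data.Product using (Σ; ∃; ∃-syntax; _×_; _,_)
open import Data.Sum using (_⊎_)
open import Relation.Binary.PropositionalEquality using (_≡_; _≢_)
open import Relation.Nullary using (¬_)
open import Function using (_∘_)
open import Function.Bundles using (_⇔_)

data Label : Set where
  fat slim : Label

isFat : Label → Bool
isFat fat  = true
isFat slim = false

isSlim : Label → Bool
isSlim fat  = false
isSlim slim = true

count : ∀ {n} → (Fin n → Bool) → ℕ
count {zero}  p = 0
count {suc n} p = (if p zero then 1 else 0) + count (p ∘ suc)

record LabGraph : Set where
  field
    n     : ℕ
    adj   : Fin n → Fin n → Bool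
    label : Fin n → Label
open LabGraph public

record Iso (G G′ : LabGraph) : Set where
  field
    to       : Fin (n G) → Fin (n G′)
    from     : Fin (n G′) → Fin (n G)
    to-from  : ∀ y → to (from y) ≡ y
    from-to  : ∀ x → from (to x) ≡ x
    adj-pres : ∀ x y → adj G′ (to x) (to y) ≡ adj G x y
    lab-pres : ∀ x → label G′ (to x) ≡ label G x
open Iso public

record HoffmanGraph : Set where
  field
    lab        : LabGraph
    adj-sym    : ∀ x y → adj lab x y ≡ adj lab y x
    adj-irrefl : ∀ x → adj lab x x ≡ false
    fat-nonadj : ∀ x y → label lab x ≡ fat → label lab y ≡ fat → adj lab x y ≡ false
    fat-slimNb : ∀ x → label lab x ≡ fat →
                 ∃[ y ] (adj lab x y ≡ true × label lab y ≡ slim)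
open HoffmanGraph public

V : HoffmanGraph → ℕ
V h = n (lab h)

_~_ : {h : HoffmanGraph} → Fin (V h) → Fin (V h) → Set
_~_ {h} x y = adj (lab h) x y ≡ true

commonFat : (h : HoffmanGraph) → Fin (V h) → Fin (V h) → ℕ
commonFat h x y = count (λ z → isFat (label (lab h) z) ∧ (adj (lab h) x z ∧ adj (lab h) y z))

numFat numSlim : HoffmanGraph → ℕ
numFat  h = count (λ z → isFat  (label (lab h) z))
numSlim h = count (λ z → isSlim (label (lab h) z))

IsFatHG : HoffmanGraph → Set
IsFatHG h = ∀ x → label (lab h) x ≡ slim →
            ∃[ y ] (adj (lab h) x y ≡ true × label (lab h) y ≡ fat)

IsSlimGraph : HoffmanGraph → Set
IsSlimGraph h = ∀ x → label (lab h) x ≡ slim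

data Reach (G : LabGraph) : Fin (n G) → Fin (n G) → Set where
  here : ∀ {x} → Reach G x x
  step : ∀ {x y z} → adj G x y ≡ true → Reach G y z → Reach G x z

Connected : HoffmanGraph → Set
Connected h = ∀ x y → Reach (lab h) x y

-- Hoffman subgraphs of h: induced subgraphs (given by an injective list
-- of vertices ι) with restricted labelling which are themselves Hoffman
-- graphs (every fat vertex has a slim neighbour inside).

record SubHG (h : HoffmanGraph) : Set where
  field
    m       : ℕ
    ι       : Fin m → Fin (V h)
    ι-inj   : ∀ a b → ι a ≡ ι b → a ≡ b
    fatNb   : ∀ a → label (lab h) (ι a) ≡ fat →
              ∃[ b ] (adj (lab h) (ι a) (ι b) ≡ true × label (lab h) (ι b) ≡ slim)
open SubHG public

induced : {h : HoffmanGraph} → SubHG h → LabGraph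
induced {h} s = record { n = m s ; adj = λ a b → adj (lab h) (ι s a) (ι s b)
                       ; label = λ a → label (lab h) (ι s a) }

_∈V_ : {h : HoffmanGraph} → Fin (V h) → SubHG h → Set
v ∈V s = ∃[ a ] (ι s a ≡ v)

record IsSum (h : HoffmanGraph) (k : ℕ) (part : Fin k → SubHG h) : Set where
  field
    cover     : ∀ v → ∃[ i ] (v ∈V part i)
    slimCover : ∀ v → label (lab h) v ≡ slim → ∃[ i ] (v ∈V part i)
    slimDisj  : ∀ v → label (lab h) v ≡ slim → ∀ i j →
                v ∈V part i → v ∈V part j → i ≡ j
    fatNbIn   : ∀ i x → x ∈V part i → label (lab h) x ≡ slim →
                ∀ w → label (lab h) w ≡ fat → adj (lab h) x w ≡ true → w ∈V part i
    cross≤1   : ∀ i j → i ≢ j → ∀ x y → x ∈V part i → y ∈V part j →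
                label (lab h) x ≡ slim → label (lab h) y ≡ slim →
                commonFat h x y ≤ 1
    cross≡1   : ∀ i j → i ≢ j → ∀ x y → x ∈V part i → y ∈V part j →
                label (lab h) x ≡ slim → label (lab h) y ≡ slim →
                (commonFat h x y ≡ 1 ⇔ adj (lab h) x y ≡ true)

Decomposable : HoffmanGraph → Set
Decomposable h = Σ (Fin 2 → SubHG h) λ part →
  IsSum h 2 part × (∀ i → 1 ≤ m (part i))

Indecomposable : HoffmanGraph → Set
Indecomposable h = ¬ Decomposable h

h₂adj : Fin 3 → Fin 3 → Bool
h₂adj zero (suc _) = true
h₂adj (suc _) zero = true
h₂adj _ _ = false

h₂lab : Fin 3 → Label
h₂lab zero = slim
h₂lab (suc _) = fat

h₂ : LabGraph
h₂ = record { n = 3 ; adj = h₂adj ; label = h₂lab }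

IsH₂ : HoffmanGraph → Set
IsH₂ h = Iso (lab h) h₂

Family : Set₁
Family = HoffmanGraph → Set

_∈F_ : LabGraph → Family → Set
G ∈F ℋ = Σ HoffmanGraph λ h → ℋ h × Iso G (lab h)

InO : HoffmanGraph → Set
InO h = IsH₂ h ⊎
        (Indecomposable h × IsFatHG h × 2 ≤ numSlim h × numFat h ≡ 1)

_⊆O : Family → Set
ℋ ⊆O = ∀ h → ℋ h → lab h ∈F InO

closure : Family → Family
closure ℋ h = IsH₂ h ⊎
  (InO h × Σ HoffmanGraph λ h′ → ℋ h′ × Σ (SubHG h′) λ s → Iso (lab h) (induced s))

record Cover (ℋ : Family) (g : HoffmanGraph) : Set where
  field
    hc      : HoffmanGraph
    k       : ℕ
    part    : Fin k → SubHG hc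
    isSum   : IsSum hc k part
    partInℋ : ∀ i → induced (part i) ∈F ℋ
    e       : Fin (V g) → Fin (V hc)
    e-inj   : ∀ x y → e x ≡ e y → x ≡ y
    e-adj   : ∀ x y → adj (lab hc) (e x) (e y) ≡ adj (lab g) x y
    e-lab   : ∀ x → label (lab hc) (e x) ≡ label (lab g) x
open Cover public

IsLine : Family → HoffmanGraph → Set
IsLine ℋ g = Cover ℋ g

Strict : {ℋ : Family} {g : HoffmanGraph} → Cover ℋ g → Set
Strict {g = g} c = ∀ v → label (lab (hc c)) v ≡ slim → ∃[ x ] (e c x ≡ v)

record StrictCover (ℋ : Family) (g : HoffmanGraph) : Set where
  field
    cov    : Cover ℋ g
    strict : Strict cov
open StrictCover public

Equivalent : {ℋ : Family} {g : HoffmanGraph} → StrictCover ℋ g → StrictCover ℋ g → Set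
Equivalent c c′ = Σ (Iso (lab (hc (cov c))) (lab (hc (cov c′)))) λ φ →
  ∀ x → to φ (e (cov c) x) ≡ e (cov c′) x

UniqueStrictCover : Family → HoffmanGraph → Set
UniqueStrictCover ℋ g = StrictCover ℋ g × (∀ c c′ → Equivalent {ℋ} {g} c c′)

ConnSlimLine : Family → HoffmanGraph → Set
ConnSlimLine ℋ g = IsSlimGraph g × Connected g × IsLine ℋ g

{-# OPTIONS --safe #-}
module Submission where

open import Defs
open import Data.Bool using (Bool; true; false; _∧_; not)
import Data.Bool as Bool
open import Data.Bool.Properties using (∧-conicalˡ; ∧-conicalʳ; ∧-identityʳ; ¬-not)
open import Data.Empty using (⊥-elim)
open import Data.Fin using (Fin; zero; suc; _≟_; _<_; fromℕ<; splitAt; join; punchIn; punchOut)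
open import Data.Fin.Properties using (any?; all?; 0≢1+n; splitAt-join; join-splitAt)
import Data.Fin.Properties as Fin
open import Data.Nat using (ℕ; zero; suc; _≤_; z≤n; s≤s; _≤′_; ≤′-refl; ≤′-step)
import Data.Nat as ℕ
open import Data.Nat.Properties using (≤-refl; ≤-trans; ≤-antisym; suc-injective; m≤n+m; n≮0; ≤⇒≤′; ≤′⇒≤)
open import Data.Product using (Σ; ∃-syntax; _×_; _,_; proj₁; proj₂)
open import Data.Sum using (_⊎_; inj₁; inj₂)
open import Data.Sum.Properties using (inj₁-injective; inj₂-injective)
open import Data.Unit using (⊤; tt)
open import Function using (_∘_)
open import Function.Bundles using (mk⇔; Equivalence)
open import Relation.Binary.Construct.Closure.ReflexiveTransitive using (Star; ε; _◅_; _◅◅_; gmap; reverse)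
open import Relation.Binary.PropositionalEquality using (_≡_; _≢_; refl; sym; trans; cong; cong₂; subst)
open import Relation.Nullary using (¬_; Dec; yes; no; does)
open import Relation.Nullary.Decidable using (map′; ¬?; _→-dec_; _×-dec_; _⊎-dec_)

-- The fat vertices of a cover of a slim graph g are "lines" on the vertices of g: adjacent vertices lie on a
-- common line, two vertices on at most one, and a vertex on two lines is adjacent to everything on them.
-- A strict cover is determined up to equivalence by which triples of vertices are collinear: a vertex lying on
-- only one line with at least two points has a second (pendant) fat neighbour iff it is adjacent to all of that line.
--
-- Any cover can be made strict without changing collinearity of distinct points: drop the other slim vertices,
-- split the remaining blocks into their co-components, and turn singletons into copies of h₂ by a new pendant fat
-- vertex. Hence, if uniqueness holds for order m ≥ 3 and g has order m + 1, two strict covers h, h′ of g induce the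
-- same collinear triples on g − v whenever v is not a cut vertex. Now take x, y, z collinear in h. Of two non-cut
-- vertices, either one lies outside {x, y, z} and we are done, or both lie inside, say p and q, with third
-- vertex r. Then {p, r} and {q, r} are collinear in h′; if these lines differ, r is adjacent to p and q, and
-- growing the connected set {p, q, r} to all but one vertex yields a non-cut vertex outside it.

-- Booleans and labels

true≢false : ∀ {b} → b ≡ true → b ≢ false
true≢false refl ()

∧-intro : ∀ {b c} → b ≡ true → c ≡ true → b ∧ c ≡ true
∧-intro refl refl = refl

≡-from-⇔ : ∀ {b c} → (b ≡ true → c ≡ true) → (c ≡ true → b ≡ true) → b ≡ c
≡-from-⇔ {true}          f g = sym (f refl)
≡-from-⇔ {false} {true}  f g = g refl
≡-from-⇔ {false} {false} f g = refl

isFat-true : ∀ {l} → isFat l ≡ true → l ≡ fat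
isFat-true {fat} _ = refl

isSlim-true : ∀ {l} → isSlim l ≡ true → l ≡ slim
isSlim-true {slim} _ = refl

slim≢fat : ∀ {l} → l ≡ slim → l ≢ fat
slim≢fat refl ()

-- Finite sets

count-pos : ∀ {n} {p : Fin n → Bool} z → p z ≡ true → 1 ≤ count p
count-pos {p = p} zero pz rewrite pz = s≤s z≤n
count-pos {p = p} (suc z) pz = ≤-trans (count-pos z pz) (m≤n+m _ _)

count-pos⁻¹ : ∀ {n} {p : Fin n → Bool} → 1 ≤ count p → ∃[ z ] (p z ≡ true)
count-pos⁻¹ {suc n} {p} le with p zero in eq
... | true = zero , eq
... | false with count-pos⁻¹ {n} le
...   | z , pz = suc z , pz

count≤1-unique : ∀ {n} {p : Fin n → Bool} → count p ≤ 1 → ∀ {y z} → p y ≡ true → p z ≡ true → y ≡ z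
count≤1-unique le {zero}  {zero}  py pz = refl
count≤1-unique le {zero}  {suc z} py pz rewrite py with ≤-trans (s≤s (count-pos z pz)) le
... | s≤s ()
count≤1-unique le {suc y} {zero}  py pz rewrite pz with ≤-trans (s≤s (count-pos y py)) le
... | s≤s ()
count≤1-unique le {suc y} {suc z} py pz =
  cong suc (count≤1-unique (≤-trans (m≤n+m _ _) le) py pz)

count-none : ∀ {n} {p : Fin n → Bool} → (∀ z → p z ≢ true) → count p ≡ 0
count-none {zero} none = refl
count-none {suc n} {p} none rewrite ¬-not (none zero) = count-none (none ∘ suc)

unique-count≤1 : ∀ {n} {p : Fin n → Bool} → (∀ {y z} → p y ≡ true → p z ≡ true → y ≡ z) → count p ≤ 1
unique-count≤1 {zero} u = z≤n
unique-count≤1 {suc n} {p} u with p zero in eq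
... | false = unique-count≤1 (λ py pz → Fin.suc-injective (u py pz))
... | true rewrite count-none {p = p ∘ suc} (λ z pz → 0≢1+n (u eq pz)) = ≤-refl

unique-count≡1 : ∀ {n} {p : Fin n → Bool} {z} → p z ≡ true → (∀ {y} → p y ≡ true → y ≡ z) → count p ≡ 1
unique-count≡1 {p = p} {z} pz u = ≤-antisym (unique-count≤1 (λ py py′ → trans (u py) (sym (u py′)))) (count-pos {p = p} z pz)

distinct-count≥2 : ∀ {n} {p : Fin n → Bool} {y z} → y ≢ z → p y ≡ true → p z ≡ true → 2 ≤ count p
distinct-count≥2 {p = p} {y} {z} y≢z py pz with count p in eq
... | 0 = ⊥-elim (n≮0 (subst (1 ≤_) eq (count-pos {p = p} y py)))
... | 1 = ⊥-elim (y≢z (count≤1-unique {p = p} (subst (_≤ 1) (sym eq) ≤-refl) py pz))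
... | suc (suc _) = s≤s (s≤s z≤n)

count-cong : ∀ {n} {p q : Fin n → Bool} → (∀ z → p z ≡ q z) → count p ≡ count q
count-cong {zero} p≗q = refl
count-cong {suc n} p≗q rewrite p≗q zero | count-cong (p≗q ∘ suc) = refl

count-remove : ∀ {n} {p : Fin n → Bool} u → p u ≡ true →
               count p ≡ suc (count (λ z → p z ∧ not (does (z ≟ u))))
count-remove {p = p} zero pu rewrite pu =
  cong suc (count-cong (λ z → sym (∧-identityʳ (p (suc z)))))
count-remove {p = p} (suc u) pu rewrite ∧-identityʳ (p zero) with p zero
... | true  = cong suc (count-remove u pu)
... | false = count-remove u pu

count≥2-other : ∀ {n} {p : Fin n → Bool} → 2 ≤ count p → ∀ s → ∃[ z ] (z ≢ s × p z ≡ true)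
count≥2-other {p = p} 2≤ s with any? (λ z → ¬? (z ≟ s) ×-dec (p z Bool.≟ true))
... | yes r = r
... | no none with ≤-trans 2≤ (unique-count≤1 {p = p} λ {y} {z} py pz → trans (only y py) (sym (only z pz)))
  where
  only : ∀ y → p y ≡ true → y ≡ s
  only y py with y ≟ s
  ... | yes eq = eq
  ... | no ne = ⊥-elim (none (y , ne , py))
...   | s≤s ()

splitAt-injective : ∀ m {n} {u v : Fin (m ℕ.+ n)} → splitAt m u ≡ splitAt m v → u ≡ v
splitAt-injective m {n} {u} {v} eq = trans (sym (join-splitAt m n u)) (trans (cong (join m n) eq) (join-splitAt m n v))

-- A decidable vertex set as an injective list, the form in which `SubHG` describes a subgraph.
record Enumeration {n} (Q : Fin n → Set) : Set where
  field
    size      : ℕ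
    elem      : Fin size → Fin n
    injective : ∀ a b → elem a ≡ elem b → a ≡ b
    sound     : ∀ a → Q (elem a)
    complete  : ∀ {v} → Q v → ∃[ a ] (elem a ≡ v)

enumerate : ∀ {n} {Q : Fin n → Set} → (∀ v → Dec (Q v)) → Enumeration Q
enumerate {zero} Q? = record
  { size = 0 ; elem = λ () ; injective = λ () ; sound = λ () ; complete = λ { {()} } }
enumerate {suc n} {Q} Q? with Q? zero | enumerate {n} (Q? ∘ suc)
... | no ¬q | E = record
  { size = size ; elem = suc ∘ elem
  ; injective = λ a b eq → injective a b (Fin.suc-injective eq)
  ; sound = sound ; complete = cmp }
  where
  open Enumeration E
  cmp : ∀ {v} → Q v → ∃[ a ] (suc (elem a) ≡ v)
  cmp {zero} q = ⊥-elim (¬q q)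
  cmp {suc v} q with complete q
  ... | a , eq = a , cong suc eq
... | yes q₀ | E = record
  { size = suc size ; elem = el ; injective = inj ; sound = snd ; complete = cmp }
  where
  open Enumeration E
  el : Fin (suc size) → Fin (suc n)
  el zero    = zero
  el (suc a) = suc (elem a)
  inj : ∀ a b → el a ≡ el b → a ≡ b
  inj zero    zero    eq = refl
  inj (suc a) (suc b) eq = cong suc (injective a b (Fin.suc-injective eq))
  snd : ∀ a → Q (el a)
  snd zero    = q₀
  snd (suc a) = sound a
  cmp : ∀ {v} → Q v → ∃[ a ] (el a ≡ v)
  cmp {zero} q = zero , refl
  cmp {suc v} q with complete q
  ... | a , eq = suc a , cong suc eq

record Quotient {n} (_≈_ : Fin n → Fin n → Set) : Set where
  field
    classes   : ℕ
    cl        : Fin n → Fin classes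
    rep       : Fin classes → Fin n
    cl-rep    : ∀ i → cl (rep i) ≡ i
    cl-sound  : ∀ {x y} → x ≈ y → cl x ≡ cl y
    cl-exact  : ∀ {x y} → cl x ≡ cl y → x ≈ y

-- Induction on `n`: vertex `zero` either joins the class of an equivalent later vertex or opens a
-- class of its own. The purpose is to number the co-components, which become the parts of a sum.
quotient : ∀ {n} {_≈_ : Fin n → Fin n → Set} → (∀ x y → Dec (x ≈ y)) →
           (∀ {x} → x ≈ x) → (∀ {x y} → x ≈ y → y ≈ x) → (∀ {x y z} → x ≈ y → y ≈ z → x ≈ z) →
           Quotient _≈_
quotient {zero} _ _ _ _ = record
  { classes = 0 ; cl = λ () ; rep = λ () ; cl-rep = λ () ; cl-sound = λ { {()} } ; cl-exact = λ { {()} } }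
quotient {suc n} {_≈_} ≈? ≈-refl ≈-sym ≈-trans
  with quotient {n} {λ x y → suc x ≈ suc y} (λ x y → ≈? (suc x) (suc y)) ≈-refl ≈-sym ≈-trans
     | any? (λ y → ≈? zero (suc y))
... | E | yes (y₀ , 0≈y₀) = record
  { classes = classes ; cl = c ; rep = suc ∘ rep ; cl-rep = cl-rep
  ; cl-sound = λ {x} {y} → snd x y ; cl-exact = λ {x} {y} → ex x y }
  where
  open Quotient E
  c : Fin (suc n) → Fin classes
  c zero    = cl y₀
  c (suc x) = cl x
  snd : ∀ x y → x ≈ y → c x ≡ c y
  snd zero    zero    _ = refl
  snd zero    (suc y) r = cl-sound (≈-trans (≈-sym 0≈y₀) r)
  snd (suc x) zero    r = cl-sound (≈-trans r 0≈y₀)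
  snd (suc x) (suc y) r = cl-sound r
  ex : ∀ x y → c x ≡ c y → x ≈ y
  ex zero    zero    _  = ≈-refl
  ex zero    (suc y) eq = ≈-trans 0≈y₀ (cl-exact eq)
  ex (suc x) zero    eq = ≈-trans (cl-exact eq) (≈-sym 0≈y₀)
  ex (suc x) (suc y) eq = cl-exact eq
... | E | no lone = record
  { classes = suc classes ; cl = c ; rep = r ; cl-rep = cr
  ; cl-sound = λ {x} {y} → snd x y ; cl-exact = λ {x} {y} → ex x y }
  where
  open Quotient E
  c : Fin (suc n) → Fin (suc classes)
  c zero    = zero
  c (suc x) = suc (cl x)
  r : Fin (suc classes) → Fin (suc n)
  r zero    = zero
  r (suc i) = suc (rep i)
  cr : ∀ i → c (r i) ≡ i
  cr zero    = refl
  cr (suc i) = cong suc (cl-rep i)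
  snd : ∀ x y → x ≈ y → c x ≡ c y
  snd zero    zero    _ = refl
  snd zero    (suc y) r = ⊥-elim (lone (y , r))
  snd (suc x) zero    r = ⊥-elim (lone (x , ≈-sym r))
  snd (suc x) (suc y) r = cong suc (cl-sound r)
  ex : ∀ x y → c x ≡ c y → x ≈ y
  ex zero    zero    _  = ≈-refl
  ex (suc x) (suc y) eq = cl-exact (Fin.suc-injective eq)

-- Reachability

-- Elimination of one vertex, as in Warshall's algorithm: reachability without `zero` is decidable
-- by induction, and `R` expresses reachability on all vertices through it.
star? : ∀ {n} {E : Fin n → Fin n → Set} → (∀ x y → Dec (E x y)) → ∀ x y → Dec (Star E x y)
star? {suc n} {E} E? x y = map′ (to-star x y) (from-star x y) (R? x y)
  where
  E⁺ : Fin n → Fin n → Set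
  E⁺ x y = E (suc x) (suc y)
  -- Paths are classified by their first and last visit to zero.
  From₀ To₀ : Fin n → Set
  From₀ y = ∃[ z ] (E zero (suc z) × Star E⁺ z y)
  To₀ x = ∃[ z ] (Star E⁺ x z × E (suc z) zero)
  R : Fin (suc n) → Fin (suc n) → Set
  R zero    zero    = ⊤
  R zero    (suc y) = From₀ y
  R (suc x) zero    = To₀ x
  R (suc x) (suc y) = Star E⁺ x y ⊎ (To₀ x × From₀ y)
  star⁺? : ∀ x y → Dec (Star E⁺ x y)
  star⁺? = star? (λ x y → E? (suc x) (suc y))
  from₀? : ∀ y → Dec (From₀ y)
  from₀? y = any? (λ z → E? zero (suc z) ×-dec star⁺? z y)
  to₀? : ∀ x → Dec (To₀ x)
  to₀? x = any? (λ z → star⁺? x z ×-dec E? (suc z) zero)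
  R? : ∀ x y → Dec (R x y)
  R? zero    zero    = yes tt
  R? zero    (suc y) = from₀? y
  R? (suc x) zero    = to₀? x
  R? (suc x) (suc y) = star⁺? x y ⊎-dec (to₀? x ×-dec from₀? y)
  lift : ∀ {x y} → Star E⁺ x y → Star E (suc x) (suc y)
  lift = gmap suc (λ s → s)
  to-star : ∀ x y → R x y → Star E x y
  to-star zero    zero    _ = ε
  to-star zero    (suc y) (z , s , p) = s ◅ lift p
  to-star (suc x) zero    (z , p , s) = lift p ◅◅ s ◅ ε
  to-star (suc x) (suc y) (inj₁ p) = lift p
  to-star (suc x) (suc y) (inj₂ ((z , p , s) , (z′ , s′ , p′))) = lift p ◅◅ s ◅ s′ ◅ lift p′
  cons : ∀ x y z → E x y → R y z → R x z
  cons zero    zero    z       s r = r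
  cons zero    (suc y) zero    s r = tt
  cons zero    (suc y) (suc z) s (inj₁ p) = y , s , p
  -- The path returns to `zero`, so everything before that return is forgotten.
  cons zero    (suc y) (suc z) s (inj₂ (_ , r)) = r
  cons (suc x) zero    zero    s r = x , ε , s
  cons (suc x) zero    (suc z) s r = inj₂ ((x , ε , s) , r)
  cons (suc x) (suc y) zero    s (w , p , s′) = w , s ◅ p , s′
  cons (suc x) (suc y) (suc z) s (inj₁ p) = inj₁ (s ◅ p)
  cons (suc x) (suc y) (suc z) s (inj₂ ((w , p , s′) , r)) = inj₂ ((w , s ◅ p , s′) , r)
  R-refl : ∀ x → R x x
  R-refl zero    = tt
  R-refl (suc x) = inj₁ ε
  from-star : ∀ x y → Star E x y → R x y
  from-star x .x ε = R-refl x
  from-star x y (_◅_ {j = w} s p) = cons x w y s (from-star w y p)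

-- The edge by which the path first enters `S`. With `S` the complement of a connected set, it
-- supplies a vertex for that set to absorb.
crossing : ∀ {n} {E : Fin n → Fin n → Set} (S : Fin n → Bool) {x y} → Star E x y →
           S x ≡ false → S y ≡ true → ∃[ p ] ∃[ q ] (E p q × S p ≡ false × S q ≡ true)
crossing S ε Sx Sy = ⊥-elim (true≢false Sy Sx)
crossing S (_◅_ {j = w} s p) Sx Sy with S w in eq
... | true  = _ , w , s , Sx , eq
... | false = crossing S p eq Sy

-- Non-cut vertices

Edge : ∀ {n} → (Fin n → Fin n → Bool) → Fin n → Fin n → Set
Edge a x y = a x y ≡ true

Avoiding : ∀ {n} → (Fin n → Fin n → Bool) → Fin n → Fin n → Fin n → Set
Avoiding a v x y = Edge a x y × x ≢ v × y ≢ v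

-- Connectedness of the graph minus `v`, phrased by paths of the original graph so that no smaller
-- graph has to be built here.
NonCut : ∀ {n} → (Fin n → Fin n → Bool) → Fin n → Set
NonCut a v = ∀ {x y} → x ≢ v → y ≢ v → Star (Avoiding a v) x y

module _ {n} {a : Fin n → Fin n → Bool} (a-sym : ∀ x y → a x y ≡ a y x)
         (connected : ∀ x y → Star (Edge a) x y) where

  private
    Inside : (Fin n → Bool) → Fin n → Fin n → Set
    Inside out x y = Edge a x y × out x ≡ false × out y ≡ false

  -- Adding boundary vertices one at a time to a connected set (given by its complement)
  -- keeps it connected; the vertex that is left over at the end is not a cut vertex.
  grow : ∀ k (out : Fin n → Bool) → count out ≡ suc k → ∀ r → out r ≡ false →
         (∀ x → out x ≡ false → Star (Inside out) r x) → ∃[ v ] (out v ≡ true × NonCut a v)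
  grow zero out c r r∈ conn with count-pos⁻¹ {p = out} (subst (1 ≤_) (sym c) ≤-refl)
  ... | v , v∉ = v , v∉ , λ x≢v y≢v → reverse flip (path x≢v) ◅◅ path y≢v
    where
    flip : ∀ {x y} → Avoiding a v x y → Avoiding a v y x
    flip (e , x≢ , y≢) = trans (a-sym _ _) e , y≢ , x≢
    ≢v : ∀ {x} → out x ≡ false → x ≢ v
    ≢v x∈ refl = true≢false v∉ x∈
    path : ∀ {x} → x ≢ v → Star (Avoiding a v) r x
    path {x} x≢v = gmap (λ z → z) (λ { (e , x∈ , y∈) → e , ≢v x∈ , ≢v y∈ })
      (conn x (¬-not λ x∉ → x≢v (count≤1-unique {p = out} (subst (_≤ 1) (sym c) ≤-refl) x∉ v∉)))
  grow (suc k) out c r r∈ conn with count-pos⁻¹ {p = out} (subst (1 ≤_) (sym c) (s≤s z≤n))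
  -- The path from `r` to an arbitrary outside vertex leaves the set along an edge from `p` to `u`;
  -- `u` is the vertex to add.
  ... | v , v∉ with crossing out (connected r v) r∈ v∉
  ... | p , u , e , p∈ , u∉ with grow k out′ c′ r (keep r∈) conn′
    where
    out′ : Fin n → Bool
    out′ z = out z ∧ not (does (z ≟ u))
    c′ : count out′ ≡ suc k
    c′ = suc-injective (trans (sym (count-remove u u∉)) c)
    keep : ∀ {z} → out z ≡ false → out′ z ≡ false
    keep eq rewrite eq = refl
    u∈′ : out′ u ≡ false
    u∈′ with u ≟ u
    ... | yes _ = trans (cong (_∧ false) u∉) refl
    ... | no u≢u = ⊥-elim (u≢u refl)
    widen : ∀ {x} → Star (Inside out) r x → Star (Inside out′) r x
    widen = gmap (λ z → z) λ { (e , x∈ , y∈) → e , keep x∈ , keep y∈ }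
    conn′ : ∀ x → out′ x ≡ false → Star (Inside out′) r x
    conn′ x x∈ with x ≟ u
    ... | yes refl = widen (conn p p∈) ◅◅ (e , keep p∈ , u∈′) ◅ ε
    ... | no _ = widen (conn x (trans (sym (∧-identityʳ (out x))) x∈))
  ... | w , w∉ , nc = w , ∧-conicalˡ _ _ w∉ , nc

  -- A star with centre `r` is connected, so `grow` can start from it; `w` guarantees that its
  -- complement is not empty.
  nonCut-outside-star : ∀ r {S : Fin n → Set} → (∀ x → Dec (S x)) → S r → (∀ x → S x → x ≢ r → a r x ≡ true) →
                        ∀ w → ¬ S w → ∃[ v ] (¬ S v × NonCut a v)
  nonCut-outside-star r {S} S? Sr star w ¬Sw = go (count out) refl
    where
    out : Fin n → Bool
    out x = not (does (S? x))
    out-in : ∀ {x} → S x → out x ≡ false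
    out-in {x} s with S? x
    ... | yes _ = refl
    ... | no ¬s = ⊥-elim (¬s s)
    in-out : ∀ {x} → out x ≡ false → S x
    in-out {x} eq with S? x
    ... | yes s = s
    path : ∀ x → out x ≡ false → Star (Inside out) r x
    path x x∈ with x ≟ r
    ... | yes refl = ε
    ... | no x≢r = (star x (in-out x∈) x≢r , out-in Sr , x∈) ◅ ε
    w∉ : out w ≡ true
    w∉ = ¬-not (λ eq → ¬Sw (in-out eq))
    go : ∀ c → count out ≡ c → ∃[ v ] (¬ S v × NonCut a v)
    go zero c = ⊥-elim (n≮0 (subst (1 ≤_) c (count-pos {p = out} w w∉)))
    go (suc k) c with grow k out c r (out-in Sr) path
    ... | v , v∉ , nc = v , (λ s → true≢false v∉ (out-in s)) , nc

-- Otherwise every vertex is one of the three, against the pigeonhole principle. The three need not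
-- be distinct: with one vertex repeated, this yields a different vertex.
fourth-vertex : ∀ {n} → 4 ≤ n → (x y z : Fin n) → ∃[ w ] (w ≢ x × w ≢ y × w ≢ z)
fourth-vertex {n} 4≤n x y z with any? (λ w → ¬? (w ≟ x) ×-dec ¬? (w ≟ y) ×-dec ¬? (w ≟ z))
... | yes w = w
... | no none = ⊥-elim (clash (Fin.pigeonhole 4≤n (proj₁ ∘ colour)))
  where
  pick : Fin 3 → Fin n
  pick zero          = x
  pick (suc zero)    = y
  pick (suc (suc _)) = z
  colour : ∀ w → ∃[ i ] (w ≡ pick i)
  colour w with w ≟ x | w ≟ y | w ≟ z
  ... | yes eq | _      | _      = zero , eq
  ... | no _   | yes eq | _      = suc zero , eq
  ... | no _   | no _   | yes eq = suc (suc zero) , eq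
  ... | no ≢x  | no ≢y  | no ≢z  = ⊥-elim (none (w , ≢x , ≢y , ≢z))
  clash : ¬ (∃[ i ] ∃[ j ] (i < j × proj₁ (colour i) ≡ proj₁ (colour j)))
  clash (i , j , i<j , eq) =
    Fin.<⇒≢ i<j (trans (proj₂ (colour i)) (trans (cong pick eq) (sym (proj₂ (colour j)))))

-- Line systems

-- The fat vertices of a cover, seen as point sets in the covered slim graph.
record Lines {n} (a : Fin n → Fin n → Bool) (F : Set) : Set where
  field
    on : Fin n → F → Bool

  infix 4 _∈_
  _∈_ : Fin n → F → Set
  x ∈ f = on x f ≡ true

  field
    some-line   : ∀ x → ∃[ f ] (x ∈ f)
    join-line   : ∀ {x y} → a x y ≡ true → ∃[ f ] (x ∈ f × y ∈ f)
    meet-unique : ∀ {x y f f′} → x ≢ y → x ∈ f → y ∈ f → x ∈ f′ → y ∈ f′ → f ≡ f′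
    double-adj  : ∀ {x y f f′} → f ≢ f′ → x ∈ f → x ∈ f′ → x ≢ y → y ∈ f → a x y ≡ true
    at-most-two : ∀ {x f f′ f″} → f ≢ f′ → x ∈ f → x ∈ f′ → x ∈ f″ → f″ ≡ f ⊎ f″ ≡ f′

  Only : Fin n → F → Set
  Only x f = x ∈ f × (∀ f′ → x ∈ f′ → f′ ≡ f)

  -- Points may coincide: `Coll x y y` says that `x` and `y` share a line.
  Coll : Fin n → Fin n → Fin n → Set
  Coll x y z = ∃[ f ] (x ∈ f × y ∈ f × z ∈ f)

  -- The trace of strictness: the first alternative holds at points whose part is `h₂`, the second
  -- at points of a part with one fat vertex, where indecomposability supplies a non-neighbour.
  Full : Set
  Full = ∀ x f → x ∈ f → (∃[ f′ ] (f′ ≢ f × x ∈ f′)) ⊎ (∃[ y ] (y ≢ x × y ∈ f × a x y ≡ false))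

open Lines using (Coll; Full)

-- Comparing two line systems on a connected graph

module _ {n} {a : Fin n → Fin n → Bool} (a-sym : ∀ x y → a x y ≡ a y x) (a-irrefl : ∀ x → a x x ≡ false)
         (connected : ∀ x y → Star (Edge a) x y) (4≤n : 4 ≤ n) where

  neighbour : ∀ x → ∃[ y ] (x ≢ y × a x y ≡ true)
  neighbour x with fourth-vertex 4≤n x x x
  ... | w , w≢x , _ with connected x w
  ...   | ε = ⊥-elim (w≢x refl)
  ...   | _◅_ {j = y} e _ = y , (λ { refl → true≢false e (a-irrefl x) }) , e

  -- `agree` is what uniqueness for the graphs with one non-cut vertex removed provides. Only the
  -- passage from `L` to `L′` is treated; the converse follows by exchanging them.
  module Comparison {k k′} (L : Lines a (Fin k)) (L′ : Lines a (Fin k′))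
           (agree : ∀ v → NonCut a v → ∀ {x y z} → x ≢ v → y ≢ v → z ≢ v → x ≢ y → Coll L x y z → Coll L′ x y z)
    where
    private
      module L = Lines L
      module L′ = Lines L′

    coll′? : ∀ x y z → Dec (Coll L′ x y z)
    coll′? x y z = any? (λ f → (L′.on x f Bool.≟ true) ×-dec (L′.on y f Bool.≟ true) ×-dec (L′.on z f Bool.≟ true))

    nonCut-pair : ∀ {p q r} → p ≢ q → p ≢ r → q ≢ r → NonCut a p → NonCut a q → Coll L p q r → Coll L′ p q r
    nonCut-pair {p} {q} {r} p≢q p≢r q≢r ncp ncq (f , p∈ , q∈ , r∈) with coll′? p q r
    ... | yes c = c
    -- Triples with a repeated point: deleting `q` keeps `p` and `r` on a line of `L′`, and deleting
    -- `p` keeps `q` and `r` on one.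
    ... | no ¬c with agree q ncq p≢q (q≢r ∘ sym) (q≢r ∘ sym) p≢r (f , p∈ , r∈ , r∈)
                   | agree p ncp (p≢q ∘ sym) (p≢r ∘ sym) (p≢r ∘ sym) q≢r (f , q∈ , r∈ , r∈)
    ... | f₁ , p∈₁ , r∈₁ , _ | f₂ , q∈₂ , r∈₂ , _ with f₁ ≟ f₂
    ... | yes refl = f₁ , p∈₁ , q∈₂ , r∈₁
    ... | no f₁≢f₂ = outside
      where
      S : Fin n → Set
      S x = x ≡ r ⊎ x ≡ p ⊎ x ≡ q
      star : ∀ x → S x → x ≢ r → a r x ≡ true
      star x (inj₁ x≡r) x≢r = ⊥-elim (x≢r x≡r)
      -- Lying on both `f₁` and `f₂`, the point `r` is adjacent to all their other points, so `S` is
      -- a star.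
      star x (inj₂ (inj₁ refl)) x≢r = L′.double-adj f₁≢f₂ r∈₁ r∈₂ (x≢r ∘ sym) p∈₁
      star x (inj₂ (inj₂ refl)) x≢r = L′.double-adj (f₁≢f₂ ∘ sym) r∈₂ r∈₁ (x≢r ∘ sym) q∈₂
      outside : Coll L′ p q r
      outside with fourth-vertex 4≤n r p q
      ... | w , w≢r , w≢p , w≢q
        with nonCut-outside-star a-sym connected r (λ x → (x ≟ r) ⊎-dec (x ≟ p) ⊎-dec (x ≟ q)) (inj₁ refl) star
               w (λ { (inj₁ e) → w≢r e ; (inj₂ (inj₁ e)) → w≢p e ; (inj₂ (inj₂ e)) → w≢q e })
      ... | v , v∉ , nc = agree v nc (λ e → v∉ (inj₂ (inj₁ (sym e)))) (λ e → v∉ (inj₂ (inj₂ (sym e))))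
                            (λ e → v∉ (inj₁ (sym e))) p≢q (f , p∈ , q∈ , r∈)

    other-nonCut : ∀ r → ∃[ v ] (v ≢ r × NonCut a v)
    other-nonCut r with fourth-vertex 4≤n r r r
    ... | w , w≢r , _ =
      nonCut-outside-star a-sym connected r (_≟ r) refl (λ x x≡r x≢r → ⊥-elim (x≢r x≡r)) w w≢r

    two-nonCuts : ∃[ u ] ∃[ v ] (u ≢ v × NonCut a u × NonCut a v)
    two-nonCuts with other-nonCut (fromℕ< (≤-trans (s≤s z≤n) 4≤n))
    ... | u , _ , ncu with other-nonCut u
    ... | v , v≢u , ncv = u , v , v≢u ∘ sym , ncu , ncv

    distinct-coll : ∀ {x y z} → x ≢ y → x ≢ z → y ≢ z → Coll L x y z → Coll L′ x y z
    distinct-coll {x} {y} {z} x≢y x≢z y≢z c@(f , x∈ , y∈ , z∈) = cases two-nonCuts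
      where
      cases : ∃[ u ] ∃[ v ] (u ≢ v × NonCut a u × NonCut a v) → Coll L′ x y z
      -- A non-cut vertex outside the triple is deleted outright. If both lie in the triple, its
      -- points are permuted to fit `nonCut-pair`.
      cases (u , v , u≢v , ncu , ncv) with u ≟ x | u ≟ y | u ≟ z | v ≟ x | v ≟ y | v ≟ z
      ... | no u≢x | no u≢y | no u≢z | _ | _ | _ = agree u ncu (u≢x ∘ sym) (u≢y ∘ sym) (u≢z ∘ sym) x≢y c
      ... | _ | _ | _ | no v≢x | no v≢y | no v≢z = agree v ncv (v≢x ∘ sym) (v≢y ∘ sym) (v≢z ∘ sym) x≢y c
      ... | yes refl | _ | _ | yes refl | _ | _ = ⊥-elim (u≢v refl)
      ... | yes refl | _ | _ | _ | yes refl | _ = nonCut-pair x≢y x≢z y≢z ncu ncv c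
      ... | yes refl | _ | _ | _ | _ | yes refl with nonCut-pair x≢z x≢y (y≢z ∘ sym) ncu ncv (f , x∈ , z∈ , y∈)
      ...   | f′ , x∈′ , z∈′ , y∈′ = f′ , x∈′ , y∈′ , z∈′
      cases (u , v , u≢v , ncu , ncv) | _ | yes refl | _ | yes refl | _ | _ = nonCut-pair x≢y x≢z y≢z ncv ncu c
      cases (u , v , u≢v , ncu , ncv) | _ | yes refl | _ | _ | yes refl | _ = ⊥-elim (u≢v refl)
      cases (u , v , u≢v , ncu , ncv) | _ | yes refl | _ | _ | _ | yes refl
        with nonCut-pair y≢z (x≢y ∘ sym) (x≢z ∘ sym) ncu ncv (f , y∈ , z∈ , x∈)
      ... | f′ , y∈′ , z∈′ , x∈′ = f′ , x∈′ , y∈′ , z∈′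
      cases (u , v , u≢v , ncu , ncv) | _ | _ | yes refl | yes refl | _ | _
        with nonCut-pair x≢z x≢y (y≢z ∘ sym) ncv ncu (f , x∈ , z∈ , y∈)
      ... | f′ , x∈′ , z∈′ , y∈′ = f′ , x∈′ , y∈′ , z∈′
      cases (u , v , u≢v , ncu , ncv) | _ | _ | yes refl | _ | yes refl | _
        with nonCut-pair y≢z (x≢y ∘ sym) (x≢z ∘ sym) ncv ncu (f , y∈ , z∈ , x∈)
      ... | f′ , y∈′ , z∈′ , x∈′ = f′ , x∈′ , y∈′ , z∈′
      cases (u , v , u≢v , ncu , ncv) | _ | _ | yes refl | _ | _ | yes refl = ⊥-elim (u≢v refl)

    -- Adjacent points share a line in any system. If `x` and `y` are not adjacent, `x` can have no
    -- line besides `f`, so a neighbour `z` of `x` also lies on `f`, and the triple of distinct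
    -- points `x`, `y`, `z` is carried over.
    pair-coll : ∀ {x y} → x ≢ y → Coll L x y y → Coll L′ x y y
    pair-coll {x} {y} x≢y (f , x∈ , y∈ , _) with a x y in eq
    ... | true with L′.join-line eq
    ...   | f′ , x∈′ , y∈′ = f′ , x∈′ , y∈′ , y∈′
    pair-coll {x} {y} x≢y (f , x∈ , y∈ , _) | false with neighbour x
    ... | z , x≢z , e with L.join-line e
    ... | f₁ , x∈₁ , z∈₁ with f ≟ f₁
    ... | no f≢f₁ = ⊥-elim (true≢false (L.double-adj f≢f₁ x∈ x∈₁ x≢y y∈) eq)
    ... | yes refl with distinct-coll x≢y x≢z (λ { refl → true≢false e eq }) (f , x∈ , y∈ , z∈₁)
    ... | f′ , x∈′ , y∈′ , _ = f′ , x∈′ , y∈′ , y∈′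

    coll-preserved : ∀ {x y z} → x ≢ y → Coll L x y z → Coll L′ x y z
    coll-preserved {x} {y} {z} x≢y c@(f , x∈ , y∈ , z∈) with x ≟ z | y ≟ z
    ... | no x≢z | no y≢z = distinct-coll x≢y x≢z y≢z c
    ... | _ | yes refl = pair-coll x≢y c
    ... | yes refl | no _ with pair-coll x≢y (f , x∈ , y∈ , y∈)
    ...   | f′ , x∈′ , y∈′ , _ = f′ , x∈′ , y∈′ , x∈′

  -- If `f` and `g` differed, a line joining `x` to a neighbour would be one of them, as they are
  -- the only lines through `x`. Then both would contain two common points.
  same-points-unique : ∀ {k} (L : Lines a (Fin k)) → let open Lines L in
                       ∀ {f g x} → x ∈ f → (∀ y → on y f ≡ on y g) → f ≡ g
  same-points-unique L {f} {g} {x} x∈f same with f ≟ g | neighbour x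
  ... | yes f≡g | _ = f≡g
  ... | no f≢g | y , x≢y , e with Lines.join-line L e
  ... | f₁ , x∈₁ , y∈₁ with Lines.at-most-two L f≢g x∈f (trans (sym (same x)) x∈f) x∈₁
  ... | inj₁ refl = Lines.meet-unique L x≢y x∈f y∈₁ (trans (sym (same x)) x∈f) (trans (sym (same y)) y∈₁)
  ... | inj₂ refl = Lines.meet-unique L x≢y x∈f (trans (same y) y∈₁) (trans (sym (same x)) x∈f) y∈₁

  module Matching {k k′} (L : Lines a (Fin k)) (L′ : Lines a (Fin k′)) (full : Full L) (full′ : Full L′)
           (coll→ : ∀ {x y z} → x ≢ y → Coll L x y z → Coll L′ x y z)
           (coll← : ∀ {x y z} → x ≢ y → Coll L′ x y z → Coll L x y z)
    where
    private
      module L = Lines L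
      module L′ = Lines L′

    Match : Fin k → Fin k′ → Set
    Match f f′ = ∀ y → L.on y f ≡ L′.on y f′

    -- Two distinct points determine their line in either system, so its other points are exactly
    -- those collinear with them.
    long-match : ∀ {x y f} → x ≢ y → x L.∈ f → y L.∈ f → ∃[ f′ ] Match f f′
    long-match {x} {y} {f} x≢y x∈ y∈ with coll→ x≢y (f , x∈ , y∈ , y∈)
    ... | f′ , x∈′ , y∈′ , _ = f′ , λ z → ≡-from-⇔ (forth z) (back z)
      where
      forth : ∀ z → z L.∈ f → z L′.∈ f′
      forth z z∈ with coll→ x≢y (f , x∈ , y∈ , z∈)
      ... | f″ , x∈″ , y∈″ , z∈″ rewrite L′.meet-unique x≢y x∈′ y∈′ x∈″ y∈″ = z∈″
      back : ∀ z → z L′.∈ f′ → z L.∈ f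
      back z z∈ with coll← x≢y (f′ , x∈′ , y∈′ , z∈)
      ... | f″ , x∈″ , y∈″ , z∈″ rewrite L.meet-unique x≢y x∈ y∈ x∈″ y∈″ = z∈″

    -- A line with a single point x is matched through the other line f₂ of x.
    match : ∀ {f x} → x L.∈ f → ∃[ f′ ] Match f f′
    match {f} {x} x∈ with any? (λ y → ¬? (x ≟ y) ×-dec (L.on y f Bool.≟ true))
    ... | yes (y , x≢y , y∈) = long-match x≢y x∈ y∈
    ... | no none with full x f x∈ | neighbour x
    ... | inj₂ (y , y≢x , y∈ , _) | _ = ⊥-elim (none (y , y≢x ∘ sym , y∈))
    ... | inj₁ (f₂ , f₂≢f , x∈₂) | y , x≢y , e with L.join-line e
    ... | f₁ , x∈₁ , y∈₁ with L.at-most-two (f₂≢f ∘ sym) x∈ x∈₂ x∈₁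
    ... | inj₁ refl = ⊥-elim (none (y , x≢y , y∈₁))
    ... | inj₂ refl with long-match x≢y x∈₂ y∈₁
    ... | f₂′ , same with full′ x f₂′ (trans (sym (same x)) x∈₂)
    -- A non-neighbour of `x` on `f₂′` would lie on `f₂`, but `x` is on both `f₂` and `f` and so
    -- adjacent to all of `f₂`. Hence `x` has a second line `f′` in `L′`.
    ... | inj₂ (z , z≢x , z∈ , x≁z) =
            ⊥-elim (true≢false (L.double-adj f₂≢f x∈₂ x∈ (z≢x ∘ sym) (trans (same z) z∈)) x≁z)
    ... | inj₁ (f′ , f′≢f₂′ , x∈′) = f′ , λ z → ≡-from-⇔ (forth z) (back z)
      where
      forth : ∀ z → z L.∈ f → z L′.∈ f′
      forth z z∈ with x ≟ z
      ... | yes refl = x∈′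
      ... | no x≢z = ⊥-elim (none (z , x≢z , z∈))
      back : ∀ z → z L′.∈ f′ → z L.∈ f
      back z z∈ with x ≟ z
      ... | yes refl = x∈
      -- The points `x` and `z` share a line of `L`. It cannot be `f₂`, for then `f₂′` and `f′`
      -- would have both points in common; so it is `f`.
      ... | no x≢z with coll← x≢z (f′ , x∈′ , z∈ , z∈)
      ... | f₄ , x∈₄ , z∈₄ , _ with L.at-most-two (f₂≢f ∘ sym) x∈ x∈₂ x∈₄
      ... | inj₁ refl = z∈₄
      ... | inj₂ refl = ⊥-elim (f′≢f₂′ (L′.meet-unique x≢z x∈′ z∈
                          (trans (sym (same x)) x∈₂) (trans (sym (same z)) z∈₄)))

-- For a point x whose only line is f, the co-component of x on f together with f embeds into a member of ℋ.
record Embedding (ℋ : Family) {n} {a : Fin n → Fin n → Bool} {F} (L : Lines a F) (x : Fin n) (f : F) : Set₁ where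
  open Lines L hiding (Coll; Full)
  field
    host     : HoffmanGraph
    host∈ℋ   : ℋ host
    -- Any set containing the co-component will do, which lets all points in one part of a cover
    -- serve as the block without knowing that they are co-connected.
    Block    : Fin n → Set
    base     : Block x
    closed   : ∀ {y z} → Block y → y ∈ f → z ∈ f → y ≢ z → a y z ≡ false → Block z
    φ        : ∀ y → Block y → Fin (V host)
    apex     : Fin (V host)
    φ-slim   : ∀ {y} (b : Block y) → label (lab host) (φ y b) ≡ slim
    apex-fat : label (lab host) apex ≡ fat
    φ-inj    : ∀ {y z} (b : Block y) (c : Block z) → φ y b ≡ φ z c → y ≡ z
    φ-adj    : ∀ {y z} (b : Block y) (c : Block z) → adj (lab host) (φ y b) (φ z c) ≡ a y z
    φ-apex   : ∀ {y} (b : Block y) → adj (lab host) (φ y b) apex ≡ true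

Embedded : Family → ∀ {n} {a : Fin n → Fin n → Bool} {F} → Lines a F → Set₁
Embedded ℋ L = ∀ x f → Lines.Only L x f → Embedding ℋ L x f

-- A point whose only line consists of neighbours gets a second line of its own.
module Pendants {n} {a : Fin n → Fin n → Bool} {k} (L : Lines a (Fin k)) where
  open Lines L hiding (Coll; Full)

  Lone : Fin n → Set
  Lone y = ∃[ f ] (Only y f × (∀ z → y ≢ z → z ∈ f → a y z ≡ true))

  lone? : ∀ y → Dec (Lone y)
  lone? y = any? λ f →
    ((on y f Bool.≟ true) ×-dec all? (λ f′ → (on y f′ Bool.≟ true) →-dec (f′ ≟ f)))
    ×-dec all? (λ z → ¬? (y ≟ z) →-dec ((on z f Bool.≟ true) →-dec (a y z Bool.≟ true)))

  -- Every `y` gets a candidate pendant line, which is empty unless `y` is lone; the empty ones are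
  -- discarded by reindexing.
  on⁺ : Fin n → Fin k ⊎ Fin n → Bool
  on⁺ x (inj₁ f) = on x f
  on⁺ x (inj₂ y) = does (x ≟ y) ∧ does (lone? y)

  pendant-inv : ∀ {x y} → on⁺ x (inj₂ y) ≡ true → x ≡ y × Lone x
  pendant-inv {x} {y} eq with x ≟ y | lone? y
  ... | yes refl | yes l = refl , l

  pendant-on : ∀ {x} → Lone x → on⁺ x (inj₂ x) ≡ true
  pendant-on {x} l with x ≟ x | lone? x
  ... | yes _ | yes _ = refl
  ... | no ≢  | _     = ⊥-elim (≢ refl)
  ... | yes _ | no ¬l = ⊥-elim (¬l l)

  pendant-point : ∀ {x y w} → on⁺ x (inj₂ w) ≡ true → on⁺ y (inj₂ w) ≡ true → x ≡ y
  pendant-point p q = trans (proj₁ (pendant-inv p)) (sym (proj₁ (pendant-inv q)))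

  pendant-line : ∀ x {w w′} → on⁺ x (inj₂ w) ≡ true → on⁺ x (inj₂ w′) ≡ true → w ≡ w′
  pendant-line x p p′ = trans (sym (proj₁ (pendant-inv {x} p))) (proj₁ (pendant-inv {x} p′))

  lone-same : ∀ {x f f′} → Lone x → x ∈ f → x ∈ f′ → f ≡ f′
  lone-same (_ , (_ , only) , _) x∈ x∈′ = trans (only _ x∈) (sym (only _ x∈′))

  meet⁺ : ∀ {x y} f f′ → x ≢ y → on⁺ x f ≡ true → on⁺ y f ≡ true → on⁺ x f′ ≡ true → on⁺ y f′ ≡ true → f ≡ f′
  meet⁺ (inj₁ f) (inj₁ f′) x≢y p q p′ q′ = cong inj₁ (meet-unique x≢y p q p′ q′)
  meet⁺ (inj₁ f) (inj₂ w)  x≢y p q p′ q′ =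
    ⊥-elim (x≢y (pendant-point p′ q′))
  meet⁺ (inj₂ w) f′ x≢y p q p′ q′ = ⊥-elim (x≢y (pendant-point p q))

  double⁺ : ∀ {x y} f f′ → f ≢ f′ → on⁺ x f ≡ true → on⁺ x f′ ≡ true → x ≢ y → on⁺ y f ≡ true → a x y ≡ true
  double⁺ (inj₁ f) (inj₁ f′) f≢f′ p p′ x≢y q = double-adj (f≢f′ ∘ cong inj₁) p p′ x≢y q
  double⁺ {x} {y} (inj₁ f) (inj₂ w) f≢f′ p p′ x≢y q with pendant-inv p′
  ... | _ , f₀ , (x∈₀ , only) , nbs = nbs y x≢y (subst (y ∈_) (only f p) q)
  double⁺ (inj₂ w) f′ f≢f′ p p′ x≢y q = ⊥-elim (x≢y (pendant-point p q))

  two⁺ : ∀ {x} f f′ f″ → f ≢ f′ → on⁺ x f ≡ true → on⁺ x f′ ≡ true → on⁺ x f″ ≡ true → f″ ≡ f ⊎ f″ ≡ f′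
  two⁺ (inj₁ f) (inj₁ f′) (inj₁ f″) ne p p′ p″ with at-most-two (ne ∘ cong inj₁) p p′ p″
  ... | inj₁ eq = inj₁ (cong inj₁ eq)
  ... | inj₂ eq = inj₂ (cong inj₁ eq)
  two⁺ (inj₁ f) (inj₁ f′) (inj₂ w) ne p p′ p″ = ⊥-elim (ne (cong inj₁ (lone-same (proj₂ (pendant-inv p″)) p p′)))
  two⁺ (inj₁ f) (inj₂ w) (inj₁ f″) ne p p′ p″ = inj₁ (cong inj₁ (lone-same (proj₂ (pendant-inv p′)) p″ p))
  two⁺ {x} (inj₁ f) (inj₂ w) (inj₂ w″) ne p p′ p″ =
    inj₂ (cong inj₂ (pendant-line x p″ p′))
  two⁺ (inj₂ w) (inj₁ f′) (inj₁ f″) ne p p′ p″ = inj₂ (cong inj₁ (lone-same (proj₂ (pendant-inv p)) p″ p′))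
  two⁺ {x} (inj₂ w) (inj₁ f′) (inj₂ w″) ne p p′ p″ =
    inj₁ (cong inj₂ (pendant-line x p″ p))
  two⁺ {x} (inj₂ w) (inj₂ w′) f″ ne p p′ p″ =
    ⊥-elim (ne (cong inj₂ (pendant-line x p p′)))

  lines⁺ : Lines a (Fin k ⊎ Fin n)
  lines⁺ = record
    { on = on⁺
    ; some-line = λ x → let f , x∈ = some-line x in inj₁ f , x∈
    ; join-line = λ e → let f , x∈ , y∈ = join-line e in inj₁ f , x∈ , y∈
    ; meet-unique = meet⁺ _ _
    ; double-adj = double⁺ _ _
    ; at-most-two = two⁺ _ _ _
    }

  -- A point with neither a second line nor a non-neighbour on its line is lone, and its pendant is
  -- the second line.
  full⁺ : Full lines⁺
  full⁺ x (inj₂ w) p with pendant-inv p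
  ... | _ , f₀ , (x∈₀ , _) , _ = inj₁ (inj₁ f₀ , (λ ()) , x∈₀)
  full⁺ x (inj₁ f) p with any? (λ f′ → ¬? (f′ ≟ f) ×-dec (on x f′ Bool.≟ true))
                        | any? (λ y → ¬? (y ≟ x) ×-dec (on y f Bool.≟ true) ×-dec (a x y Bool.≟ false))
  ... | yes (f′ , ne , x∈′) | _ = inj₁ (inj₁ f′ , (λ { refl → ne refl }) , x∈′)
  ... | no _ | yes (y , r) = inj₂ (y , r)
  ... | no noLine | no noPoint = inj₁ (inj₂ x , (λ ()) , pendant-on (f , (p , only) , nbs))
    where
    only : ∀ f′ → x ∈ f′ → f′ ≡ f
    only f′ x∈′ with f′ ≟ f
    ... | yes eq = eq
    ... | no ne = ⊥-elim (noLine (f′ , ne , x∈′))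
    nbs : ∀ z → x ≢ z → z ∈ f → a x z ≡ true
    nbs z x≢z z∈ = ¬-not λ x≁z → noPoint (z , x≢z ∘ sym , z∈ , x≁z)

  coll⁺ : ∀ {x y z} → Coll L x y z → Coll lines⁺ x y z
  coll⁺ (f , r) = inj₁ f , r

  coll⁺⁻¹ : ∀ {x y z} → x ≢ y → Coll lines⁺ x y z → Coll L x y z
  coll⁺⁻¹ x≢y (inj₁ f , r) = f , r
  coll⁺⁻¹ x≢y (inj₂ w , p , q , _) = ⊥-elim (x≢y (pendant-point p q))

  -- A point on a pendant also has its old line, so a pendant is never the only line. On an old line
  -- the data for `L` can be reused.
  embedded⁺ : ∀ {ℋ} → Embedded ℋ L → Embedded ℋ lines⁺
  embedded⁺ emb x (inj₂ w) (p , only) with pendant-inv p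
  ... | _ , f₀ , (x∈₀ , _) , _ with only (inj₁ f₀) x∈₀
  ... | ()
  embedded⁺ emb x (inj₁ f) (p , only) = record { Embedding E }
    where
    E = emb x f (p , λ f′ x∈′ → inj₁-injective (only (inj₁ f′) x∈′))

-- Used to drop empty lines, which would be fat vertices without a slim neighbour, and to replace
-- the index set by some `Fin k`. Hence `d` only has to hit the lines that have a point.
module Reindex {n} {a : Fin n → Fin n → Bool} {F F′ : Set} (L : Lines a F) (d : F′ → F)
         (d-inj : ∀ {f f′} → d f ≡ d f′ → f ≡ f′)
         (d-hits : ∀ {x f} → Lines._∈_ L x f → ∃[ f′ ] (d f′ ≡ f)) where
  open Lines L hiding (Coll; Full)

  reindexed : Lines a F′
  reindexed = record
    { on = λ x f → on x (d f)
    ; some-line = some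
    ; join-line = joined
    ; meet-unique = λ x≢y p q p′ q′ → d-inj (meet-unique x≢y p q p′ q′)
    ; double-adj = λ ne → double-adj (ne ∘ d-inj)
    ; at-most-two = two
    }
    where
    some : ∀ x → ∃[ f ] (x ∈ d f)
    some x with some-line x
    ... | f , x∈ with d-hits x∈
    ... | f′ , refl = f′ , x∈
    joined : ∀ {x y} → a x y ≡ true → ∃[ f ] (x ∈ d f × y ∈ d f)
    joined e with join-line e
    ... | f , x∈ , y∈ with d-hits x∈
    ... | f′ , refl = f′ , x∈ , y∈
    two : ∀ {x f f′ f″} → f ≢ f′ → x ∈ d f → x ∈ d f′ → x ∈ d f″ → f″ ≡ f ⊎ f″ ≡ f′
    two ne p p′ p″ with at-most-two (ne ∘ d-inj) p p′ p″
    ... | inj₁ eq = inj₁ (d-inj eq)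
    ... | inj₂ eq = inj₂ (d-inj eq)

  full-reindexed : Full L → Full reindexed
  full-reindexed full x f x∈ with full x (d f) x∈
  ... | inj₂ r = inj₂ r
  ... | inj₁ (f′ , ne , x∈′) with d-hits x∈′
  ... | f″ , refl = inj₁ (f″ , ne ∘ cong d , x∈′)

  coll-reindexed : ∀ {x y z} → Coll L x y z → Coll reindexed x y z
  coll-reindexed (f , x∈ , r) with d-hits x∈
  ... | f′ , refl = f′ , x∈ , r

  coll-reindexed⁻¹ : ∀ {x y z} → Coll reindexed x y z → Coll L x y z
  coll-reindexed⁻¹ (f , r) = d f , r

  embedded-reindexed : ∀ {ℋ} → Embedded ℋ L → Embedded ℋ reindexed
  embedded-reindexed emb x f (x∈ , only) = record { Embedding (emb x (d f) (x∈ , only′)) }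
    where
    only′ : ∀ f′ → x ∈ f′ → f′ ≡ d f
    only′ f′ x∈′ with d-hits x∈′
    ... | f″ , refl = cong d (only f″ x∈′)

-- Hoffman graphs with one fat vertex

inhabited⇒1≤ : ∀ {n} → Fin n → 1 ≤ n
inhabited⇒1≤ {suc n} _ = s≤s z≤n

module _ (h : HoffmanGraph) {Q : Fin (V h) → Set} (Q? : ∀ v → Dec (Q v))
         (Q-fat : ∀ v → Q v → label (lab h) v ≡ fat →
                  ∃[ w ] (Q w × adj (lab h) v w ≡ true × label (lab h) w ≡ slim)) where
  private
    module E = Enumeration (enumerate Q?)

  subHG : SubHG h
  subHG = record { m = E.size ; ι = E.elem ; ι-inj = E.injective ; fatNb = nb }
    where
    nb : ∀ a → label (lab h) (E.elem a) ≡ fat →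
         ∃[ b ] (adj (lab h) (E.elem a) (E.elem b) ≡ true × label (lab h) (E.elem b) ≡ slim)
    nb a isfat with Q-fat (E.elem a) (E.sound a) isfat
    ... | w , q , e , l with E.complete q
    ... | b , refl = b , e , l

  subHG-sound : ∀ {v} → _∈V_ {h} v subHG → Q v
  subHG-sound (a , refl) = E.sound a

  subHG-complete : ∀ {v} → Q v → _∈V_ {h} v subHG
  subHG-complete = E.complete

inducedHG : {h : HoffmanGraph} → SubHG h → HoffmanGraph
inducedHG {h} s = record
  { lab = induced s
  ; adj-sym = λ a b → adj-sym h (ι s a) (ι s b)
  ; adj-irrefl = λ a → adj-irrefl h (ι s a)
  ; fat-nonadj = λ a b → fat-nonadj h (ι s a) (ι s b)
  ; fat-slimNb = fatNb s
  }

-- The shape of the members of the family O other than `h₂`. As all slim vertices share the fat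
-- vertex `top`, slim vertices in different parts of a decomposition must be adjacent.
record Cone (h : HoffmanGraph) : Set where
  field
    top        : Fin (V h)
    top-fat    : label (lab h) top ≡ fat
    fat-unique : ∀ {v} → label (lab h) v ≡ fat → v ≡ top
    top-adj    : ∀ {v} → label (lab h) v ≡ slim → adj (lab h) v top ≡ true

  common : ∀ {x y} → label (lab h) x ≡ slim → label (lab h) y ≡ slim → commonFat h x y ≡ 1
  common x-slim y-slim = unique-count≡1 {z = top}
    (∧-intro (cong isFat top-fat) (∧-intro (top-adj x-slim) (top-adj y-slim)))
    (λ r → fat-unique (isFat-true (∧-conicalˡ _ _ r)))

CoAdjacent : (h : HoffmanGraph) → Fin (V h) → Fin (V h) → Set
CoAdjacent h u v = label (lab h) v ≡ slim × adj (lab h) u v ≡ false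

-- A path of non-adjacencies cannot change parts, since slim vertices of different parts share `top`
-- and are adjacent. But both parts contain slim vertices, because a fat vertex brings a slim
-- neighbour.
co-connected⇒indecomposable : ∀ {h} → Cone h →
  (∀ {u v} → label (lab h) u ≡ slim → label (lab h) v ≡ slim → Star (CoAdjacent h) u v) → Indecomposable h
co-connected⇒indecomposable {h} cone conn (pt , sum , nonempty) =
  let u , u∈ , u-slim = slim-member zero
      v , v∈ , v-slim = slim-member (suc zero)
  in separate (conn u-slim v-slim) u-slim u∈ v-slim v∈
  where
  open IsSum sum
  slim-member : ∀ i → ∃[ v ] (_∈V_ {h} v (pt i) × label (lab h) v ≡ slim)
  slim-member i = go (Fin-of (nonempty i))
    where
    Fin-of : ∀ {n} → 1 ≤ n → Fin n
    Fin-of (s≤s _) = zero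
    go : Fin (m (pt i)) → ∃[ v ] (_∈V_ {h} v (pt i) × label (lab h) v ≡ slim)
    go a with label (lab h) (ι (pt i) a) in eq
    ... | slim = ι (pt i) a , (a , refl) , eq
    ... | fat with fatNb (pt i) a eq
    ...   | b , _ , l = ι (pt i) b , (b , refl) , l
  separate : ∀ {u v} → Star (CoAdjacent h) u v → label (lab h) u ≡ slim → _∈V_ {h} u (pt zero) →
             label (lab h) v ≡ slim → ¬ (_∈V_ {h} v (pt (suc zero)))
  separate {u} ε u-slim u∈ _ v∈ with slimDisj u u-slim zero (suc zero) u∈ v∈
  ... | ()
  separate {u} (_◅_ {j = w} (w-slim , u≁w) p) u-slim u∈ v-slim v∈ with slimCover w w-slim
  ... | zero , w∈ = separate p w-slim w∈ v-slim v∈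
  ... | suc zero , w∈ = true≢false
    (Equivalence.to (cross≡1 zero (suc zero) (λ ()) u w u∈ w∈ u-slim w-slim) (Cone.common cone u-slim w-slim)) u≁w

-- Otherwise the cone over s alone splits off.
nonadjacent-partner : ∀ {h} → Cone h → Indecomposable h → 2 ≤ numSlim h → ∀ {s} → label (lab h) s ≡ slim →
                      ∃[ t ] (t ≢ s × label (lab h) t ≡ slim × adj (lab h) s t ≡ false)
nonadjacent-partner {h} cone indec 2≤slim {s} s-slim
  with any? (λ t → ¬? (t ≟ s) ×-dec (isSlim (label (lab h) t) Bool.≟ true) ×-dec (adj (lab h) s t Bool.≟ false))
... | yes (t , t≢s , l , e) = t , t≢s , isSlim-true l , e
... | no none = ⊥-elim (indec (pt , sum , λ i → inhabited⇒1≤ (proj₁ (subHG-complete h (Q? i) (Q-fat i) (proj₂ (Q-some i))))))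
  where
  open Cone cone
  Q : Fin 2 → Fin (V h) → Set
  -- The fat vertex belongs to both parts; only slim vertices have to be separated.
  Q zero    v = v ≡ s ⊎ v ≡ top
  Q (suc _) v = v ≢ s
  Q? : ∀ i v → Dec (Q i v)
  Q? zero    v = (v ≟ s) ⊎-dec (v ≟ top)
  Q? (suc _) v = ¬? (v ≟ s)
  top-adj′ : ∀ {v} → label (lab h) v ≡ slim → adj (lab h) top v ≡ true
  top-adj′ l = trans (adj-sym h _ _) (top-adj l)
  Q-some : ∀ i → ∃[ v ] Q i v
  Q-some zero    = s , inj₁ refl
  Q-some (suc _) = top , λ { refl → slim≢fat s-slim top-fat }
  Q-fat : ∀ i v → Q i v → label (lab h) v ≡ fat →
          ∃[ w ] (Q i w × adj (lab h) v w ≡ true × label (lab h) w ≡ slim)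
  Q-fat zero v q v-fat rewrite fat-unique v-fat = s , inj₁ refl , top-adj′ s-slim , s-slim
  -- A second slim vertex is what gives `top` a slim neighbour in the part without `s`.
  Q-fat (suc _) v q v-fat rewrite fat-unique v-fat with count≥2-other 2≤slim s
  ... | t , t≢s , l = t , t≢s , top-adj′ (isSlim-true l) , isSlim-true l
  pt : Fin 2 → SubHG h
  pt i = subHG h (Q? i) (Q-fat i)
  inQ : ∀ i {v} → _∈V_ {h} v (pt i) → Q i v
  inQ i = subHG-sound h (Q? i) (Q-fat i)
  is-s : ∀ {v} → label (lab h) v ≡ slim → Q zero v → v ≡ s
  is-s l (inj₁ eq) = eq
  is-s l (inj₂ refl) = ⊥-elim (slim≢fat l top-fat)
  others : ∀ {v} → label (lab h) v ≡ slim → v ≢ s → adj (lab h) s v ≡ true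
  others {v} l v≢s = ¬-not λ e → none (v , v≢s , cong isSlim l , e)
  covered : ∀ v → ∃[ i ] (_∈V_ {h} v (pt i))
  covered v with v ≟ s
  ... | yes eq = zero , subHG-complete h (Q? zero) (Q-fat zero) (inj₁ eq)
  ... | no ne = suc zero , subHG-complete h (Q? (suc zero)) (Q-fat (suc zero)) ne
  disj : ∀ {v} → label (lab h) v ≡ slim → ∀ i j → Q i v → Q j v → i ≡ j
  disj l zero       zero       q q′ = refl
  disj l zero       (suc zero) q q′ = ⊥-elim (q′ (is-s l q))
  disj l (suc zero) zero       q q′ = ⊥-elim (q (is-s l q′))
  disj l (suc zero) (suc zero) q q′ = refl
  cross : ∀ i j → i ≢ j → ∀ {x y} → Q i x → Q j y → label (lab h) x ≡ slim → label (lab h) y ≡ slim →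
          adj (lab h) x y ≡ true
  cross zero       zero       ne _ _ _ _ = ⊥-elim (ne refl)
  cross zero       (suc zero) ne q q′ l l′ rewrite is-s l q = others l′ q′
  cross (suc zero) zero       ne q q′ l l′ rewrite is-s l′ q′ = trans (adj-sym h _ _) (others l q)
  cross (suc zero) (suc zero) ne _ _ _ _ = ⊥-elim (ne refl)
  fatIn : ∀ i v → label (lab h) v ≡ fat → Q i v
  fatIn zero    v l = inj₂ (fat-unique l)
  fatIn (suc _) v l refl = slim≢fat s-slim l
  sum : IsSum h 2 pt
  sum = record
    { cover = covered
    ; slimCover = λ v _ → covered v
    ; slimDisj = λ v l i j v∈ v∈′ → disj l i j (inQ i v∈) (inQ j v∈′)
    ; fatNbIn = λ i x _ _ w l _ → subHG-complete h (Q? i) (Q-fat i) (fatIn i w l)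
    ; cross≤1 = λ i j _ x y _ _ l l′ → subst (_≤ 1) (sym (common l l′)) ≤-refl
    ; cross≡1 = λ i j i≢j x y x∈ y∈ l l′ →
        mk⇔ (λ _ → cross i j i≢j (inQ i x∈) (inQ j y∈) l l′) (λ _ → common l l′)
    }

iso-h₂ : ∀ {G} (s f f′ : Fin (n G)) → (∀ v → v ≡ s ⊎ v ≡ f ⊎ v ≡ f′) → f ≢ f′ →
         label G s ≡ slim → label G f ≡ fat → label G f′ ≡ fat →
         (∀ x y → label G x ≡ fat → label G y ≡ fat → adj G x y ≡ false) →
         (∀ x y → adj G x y ≡ adj G y x) → adj G s s ≡ false → adj G s f ≡ true → adj G s f′ ≡ true → Iso G h₂
iso-h₂ {G} s f f′ all f≢f′ s-slim f-fat f′-fat fats sy ss sf sf′ = record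
  { to = to′ ; from = from′ ; to-from = tf ; from-to = ft
  ; adj-pres = λ x y → trans (adjs (to′ x) (to′ y)) (cong₂ (adj G) (ft x) (ft y))
  ; lab-pres = λ x → trans (labs (to′ x)) (cong (label G) (ft x)) }
  where
  from′ : Fin 3 → Fin (n G)
  from′ zero          = s
  from′ (suc zero)    = f
  from′ (suc (suc _)) = f′
  code : ∀ {v} → v ≡ s ⊎ v ≡ f ⊎ v ≡ f′ → Fin 3
  code (inj₁ _)        = zero
  code (inj₂ (inj₁ _)) = suc zero
  code (inj₂ (inj₂ _)) = suc (suc zero)
  decode : ∀ {v} (c : v ≡ s ⊎ v ≡ f ⊎ v ≡ f′) → from′ (code c) ≡ v
  decode (inj₁ eq)        = sym eq
  decode (inj₂ (inj₁ eq)) = sym eq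
  decode (inj₂ (inj₂ eq)) = sym eq
  to′ : Fin (n G) → Fin 3
  to′ v = code (all v)
  ft : ∀ v → from′ (to′ v) ≡ v
  ft v = decode (all v)
  from-inj : ∀ i j → from′ i ≡ from′ j → i ≡ j
  from-inj zero zero eq = refl
  from-inj zero (suc zero) refl = ⊥-elim (slim≢fat s-slim f-fat)
  from-inj zero (suc (suc zero)) refl = ⊥-elim (slim≢fat s-slim f′-fat)
  from-inj (suc zero) zero refl = ⊥-elim (slim≢fat s-slim f-fat)
  from-inj (suc zero) (suc zero) eq = refl
  from-inj (suc zero) (suc (suc zero)) eq = ⊥-elim (f≢f′ eq)
  from-inj (suc (suc zero)) zero refl = ⊥-elim (slim≢fat s-slim f′-fat)
  from-inj (suc (suc zero)) (suc zero) eq = ⊥-elim (f≢f′ (sym eq))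
  from-inj (suc (suc zero)) (suc (suc zero)) eq = refl
  tf : ∀ i → to′ (from′ i) ≡ i
  tf i = from-inj _ _ (ft (from′ i))
  labs : ∀ i → h₂lab i ≡ label G (from′ i)
  labs zero             = sym s-slim
  labs (suc zero)       = sym f-fat
  labs (suc (suc zero)) = sym f′-fat
  adjs : ∀ i j → h₂adj i j ≡ adj G (from′ i) (from′ j)
  adjs zero zero = sym ss
  adjs zero (suc zero) = sym sf
  adjs zero (suc (suc zero)) = sym sf′
  adjs (suc zero) zero = sym (trans (sy _ _) sf)
  adjs (suc (suc zero)) zero = sym (trans (sy _ _) sf′)
  adjs (suc i) (suc j) = sym (fats _ _ (sym (labs (suc i))) (sym (labs (suc j))))

-- From a line system to a strict cover

id-iso : ∀ G → Iso G G
id-iso G = record { to = λ x → x ; from = λ x → x ; to-from = λ _ → refl ; from-to = λ _ → refl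
                  ; adj-pres = λ _ _ → refl ; lab-pres = λ _ → refl }

-- Points become slim and lines fat vertices; the parts are the co-components together with their
-- lines. `nonempty` provides slim neighbours of fat vertices, `full` a second slim vertex in parts
-- with one line, and `emb` the hosts that put such parts into the closure.
module Realisation (ℋ : Family) (g : HoffmanGraph) (g-slim : IsSlimGraph g) {k} (L : Lines (adj (lab g)) (Fin k))
         (nonempty : ∀ f → ∃[ x ] (Lines._∈_ L x f)) (full : Full L) (emb : Embedded ℋ L) where
  open Lines L hiding (Coll; Full)

  W : Set
  W = Fin (V g) ⊎ Fin k

  adjW : W → W → Bool
  adjW (inj₁ x) (inj₁ y) = adj (lab g) x y
  adjW (inj₁ x) (inj₂ f) = on x f
  adjW (inj₂ f) (inj₁ x) = on x f
  adjW (inj₂ _) (inj₂ _) = false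

  labW : W → Label
  labW (inj₁ _) = slim
  labW (inj₂ _) = fat

  sp : Fin (V g ℕ.+ k) → W
  sp = splitAt (V g)

  jn : W → Fin (V g ℕ.+ k)
  jn = join (V g) k

  sp-jn : ∀ w → sp (jn w) ≡ w
  sp-jn = splitAt-join (V g) k

  graph : HoffmanGraph
  graph = record
    { lab = record { n = V g ℕ.+ k ; adj = λ u v → adjW (sp u) (sp v) ; label = λ u → labW (sp u) }
    ; adj-sym = λ u v → sy (sp u) (sp v)
    ; adj-irrefl = λ u → ir (sp u)
    ; fat-nonadj = λ u v → nonadj (sp u) (sp v)
    ; fat-slimNb = λ u l → let x , e = nb (sp u) l in
        jn (inj₁ x) , trans (cong (adjW (sp u)) (sp-jn (inj₁ x))) e , cong labW (sp-jn (inj₁ x))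
    }
    where
    sy : ∀ w w′ → adjW w w′ ≡ adjW w′ w
    sy (inj₁ x) (inj₁ y) = adj-sym g x y
    sy (inj₁ x) (inj₂ f) = refl
    sy (inj₂ f) (inj₁ x) = refl
    sy (inj₂ f) (inj₂ _) = refl
    ir : ∀ w → adjW w w ≡ false
    ir (inj₁ x) = adj-irrefl g x
    ir (inj₂ f) = refl
    nonadj : ∀ w w′ → labW w ≡ fat → labW w′ ≡ fat → adjW w w′ ≡ false
    nonadj (inj₂ _) (inj₂ _) _ _ = refl
    nb : ∀ w → labW w ≡ fat → ∃[ x ] (adjW w (inj₁ x) ≡ true)
    nb (inj₂ f) _ = nonempty f

  slim-inv : ∀ {w} → labW w ≡ slim → ∃[ x ] (w ≡ inj₁ x)
  slim-inv {inj₁ x} _ = x , refl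

  CoAdj : Fin (V g) → Fin (V g) → Set
  CoAdj x y = x ≢ y × adj (lab g) x y ≡ false × ∃[ f ] (x ∈ f × y ∈ f)

  coAdj? : ∀ x y → Dec (CoAdj x y)
  coAdj? x y = ¬? (x ≟ y) ×-dec (adj (lab g) x y Bool.≟ false)
               ×-dec any? (λ f → (on x f Bool.≟ true) ×-dec (on y f Bool.≟ true))

  coAdj-sym : ∀ {x y} → CoAdj x y → CoAdj y x
  coAdj-sym (x≢y , e , f , x∈ , y∈) = x≢y ∘ sym , trans (adj-sym g _ _) e , f , y∈ , x∈

  open Quotient (quotient (star? coAdj?) ε (reverse coAdj-sym) _◅◅_)

  InW : Fin classes → W → Set
  InW i (inj₁ x) = cl x ≡ i
  InW i (inj₂ f) = ∃[ x ] (cl x ≡ i × x ∈ f)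

  inW? : ∀ i w → Dec (InW i w)
  inW? i (inj₁ x) = cl x ≟ i
  inW? i (inj₂ f) = any? (λ x → (cl x ≟ i) ×-dec (on x f Bool.≟ true))

  in? : ∀ i u → Dec (InW i (sp u))
  in? i u = inW? i (sp u)

  in-fat : ∀ i u → InW i (sp u) → labW (sp u) ≡ fat →
           ∃[ v ] (InW i (sp v) × adjW (sp u) (sp v) ≡ true × labW (sp v) ≡ slim)
  in-fat i u q l with sp u
  ... | inj₂ f with q
  ...   | x , c , x∈ = jn (inj₁ x) , subst (λ w → InW i w × adjW (inj₂ f) w ≡ true × labW w ≡ slim)
                                       (sym (sp-jn (inj₁ x))) (c , x∈ , refl)

  pt : Fin classes → SubHG graph
  pt i = subHG graph (in? i) (in-fat i)

  in-sound : ∀ {i u} → _∈V_ {graph} u (pt i) → InW i (sp u)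
  in-sound {i} = subHG-sound graph (in? i) (in-fat i)

  in-complete : ∀ {i u} → InW i (sp u) → _∈V_ {graph} u (pt i)
  in-complete {i} = subHG-complete graph (in? i) (in-fat i)

  module _ {u v x y} (u≡x : sp u ≡ inj₁ x) (v≡y : sp v ≡ inj₁ y) where
    IsCommon : W → Bool
    IsCommon w = isFat (labW w) ∧ (adjW (sp u) w ∧ adjW (sp v) w)

    common-line : ∀ w → IsCommon w ≡ true → ∃[ f ] (w ≡ inj₂ f × x ∈ f × y ∈ f)
    common-line (inj₂ f) p = f , refl
      , trans (cong (λ w → adjW w (inj₂ f)) (sym u≡x)) (∧-conicalˡ _ _ p)
      , trans (cong (λ w → adjW w (inj₂ f)) (sym v≡y)) (∧-conicalʳ _ _ p)

    line-common : ∀ {f} → x ∈ f → y ∈ f → IsCommon (sp (jn (inj₂ f))) ≡ true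
    line-common {f} x∈ y∈ = trans (cong IsCommon (sp-jn (inj₂ f)))
      (cong₂ _∧_ (trans (cong (λ w → adjW w (inj₂ f)) u≡x) x∈) (trans (cong (λ w → adjW w (inj₂ f)) v≡y) y∈))

    commonFat≤1 : x ≢ y → commonFat graph u v ≤ 1
    commonFat≤1 x≢y = unique-count≤1 same
      where
      same : ∀ {z z′} → IsCommon (sp z) ≡ true → IsCommon (sp z′) ≡ true → z ≡ z′
      same {z} {z′} p p′ with common-line (sp z) p | common-line (sp z′) p′
      ... | f , z≡f , x∈ , y∈ | f′ , z′≡f′ , x∈′ , y∈′ =
        splitAt-injective (V g) (trans z≡f (trans (cong inj₂ (meet-unique x≢y x∈ y∈ x∈′ y∈′)) (sym z′≡f′)))

    -- Non-adjacent points on a common line are co-adjacent and hence in the same class.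
    commonFat≡1⇒adj : cl x ≢ cl y → commonFat graph u v ≡ 1 → adj (lab g) x y ≡ true
    commonFat≡1⇒adj ne c with count-pos⁻¹ {p = λ z → IsCommon (sp z)} (subst (1 ≤_) (sym c) ≤-refl)
    ... | z , p with common-line (sp z) p
    ... | f , _ , x∈ , y∈ = ¬-not λ x≁y → ne (cl-sound (((λ { refl → ne refl }) , x≁y , f , x∈ , y∈) ◅ ε))

    adj⇒commonFat≡1 : x ≢ y → adj (lab g) x y ≡ true → commonFat graph u v ≡ 1
    adj⇒commonFat≡1 x≢y e with join-line e
    ... | f , x∈ , y∈ = ≤-antisym (commonFat≤1 x≢y)
                          (count-pos {p = λ z → IsCommon (sp z)} (jn (inj₂ f)) (line-common x∈ y∈))

  is-sum : IsSum graph classes pt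
  is-sum = record
    { cover = covered
    ; slimCover = λ u _ → covered u
    ; slimDisj = λ u l i j u∈ u∈′ → disj l (in-sound u∈) (in-sound u∈′)
    ; fatNbIn = λ i u u∈ l w l′ e → in-complete (nbIn (sp u) (sp w) (in-sound u∈) l l′ e)
    ; cross≤1 = λ i j i≢j u v u∈ v∈ l l′ →
        let x , u≡x = slim-inv l ; y , v≡y = slim-inv l′
        in commonFat≤1 u≡x v≡y (λ x≡y → cl-differ i≢j u≡x v≡y u∈ v∈ (cong cl x≡y))
    ; cross≡1 = λ i j i≢j u v u∈ v∈ l l′ →
        let x , u≡x = slim-inv l ; y , v≡y = slim-inv l′ ; ne = cl-differ i≢j u≡x v≡y u∈ v∈
        in mk⇔ (λ c → trans (cong₂ adjW u≡x v≡y) (commonFat≡1⇒adj u≡x v≡y ne c))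
               (λ e → adj⇒commonFat≡1 u≡x v≡y (ne ∘ cong cl) (trans (sym (cong₂ adjW u≡x v≡y)) e))
    }
    where
    covered : ∀ u → ∃[ i ] (_∈V_ {graph} u (pt i))
    covered u = let i , q = inSome (sp u) in i , in-complete q
      where
      inSome : ∀ w → ∃[ i ] InW i w
      inSome (inj₁ x) = cl x , refl
      inSome (inj₂ f) = let x , x∈ = nonempty f in cl x , x , refl , x∈
    disj : ∀ {i j w} → labW w ≡ slim → InW i w → InW j w → i ≡ j
    disj {w = inj₁ x} _ c c′ = trans (sym c) c′
    nbIn : ∀ {i} w w′ → InW i w → labW w ≡ slim → labW w′ ≡ fat → adjW w w′ ≡ true → InW i w′
    nbIn (inj₁ x) (inj₂ f) c _ _ x∈ = x , c , x∈
    cl-of : ∀ {i u x} → sp u ≡ inj₁ x → _∈V_ {graph} u (pt i) → cl x ≡ i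
    cl-of {i} u≡x u∈ = subst (InW i) u≡x (in-sound u∈)
    cl-differ : ∀ {i j u v x y} → i ≢ j → sp u ≡ inj₁ x → sp v ≡ inj₁ y →
                _∈V_ {graph} u (pt i) → _∈V_ {graph} v (pt j) → cl x ≢ cl y
    cl-differ i≢j u≡x v≡y u∈ v∈ eq = i≢j (trans (sym (cl-of u≡x u∈)) (trans eq (cl-of v≡y v∈)))

  -- A point on two lines is adjacent to everything on each of its lines, so it has no co-neighbour.
  double-class : ∀ {x y f f′} → f ≢ f′ → x ∈ f → x ∈ f′ → Star CoAdj x y → y ≡ x
  double-class f≢f′ x∈ x∈′ ε = refl
  double-class {f = f} f≢f′ x∈ x∈′ ((x≢z , x≁z , f₁ , x∈₁ , z∈₁) ◅ _) with f ≟ f₁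
  ... | yes refl = ⊥-elim (true≢false (double-adj f≢f′ x∈ x∈′ x≢z z∈₁) x≁z)
  ... | no f≢f₁ = ⊥-elim (true≢false (double-adj (f≢f₁ ∘ sym) x∈₁ x∈ x≢z z∈₁) x≁z)

  -- If a co-neighbour `z` of `x` had a line besides `f`, then `double-adj` at `z` would make it
  -- adjacent to `x`.
  only-class : ∀ {x y f} → Only x f → Star CoAdj x y → Only y f
  only-class o ε = o
  only-class {x} {f = f} (x∈ , only) (_◅_ {j = z} (x≢z , x≁z , f₁ , x∈₁ , z∈₁) p) with only f₁ x∈₁
  ... | refl = only-class (z∈₁ , z-only) p
    where
    z-only : ∀ f′ → z ∈ f′ → f′ ≡ f
    z-only f′ z∈′ with f′ ≟ f
    ... | yes eq = eq
    ... | no f′≢f = ⊥-elim (true≢false (trans (adj-sym g x z)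
                      (double-adj (f′≢f ∘ sym) z∈₁ z∈′ (x≢z ∘ sym) x∈)) x≁z)

  module Part (i : Fin classes) where
    H : HoffmanGraph
    H = inducedHG (pt i)

    at : Fin (V H) → W
    at b = sp (ι (pt i) b)

    at-inj : ∀ {b c} → at b ≡ at c → b ≡ c
    at-inj eq = ι-inj (pt i) _ _ (splitAt-injective (V g) eq)

    at-sound : ∀ b → InW i (at b)
    at-sound b = in-sound (b , refl)

    idx : ∀ w → InW i w → ∃[ b ] (at b ≡ w)
    idx w q with in-complete {i} {jn w} (subst (InW i) (sym (sp-jn w)) q)
    ... | b , eq = b , trans (cong sp eq) (sp-jn w)

    x : Fin (V g)
    x = rep i

    path : ∀ {y} → cl y ≡ i → Star CoAdj x y
    path c = cl-exact (trans (cl-rep i) (sym c))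

    module Double {f f′} (f≢f′ : f ≢ f′) (x∈ : x ∈ f) (x∈′ : x ∈ f′) where
      is-h₂ : IsH₂ H
      is-h₂ with idx (inj₁ x) (cl-rep i) | idx (inj₂ f) (x , cl-rep i , x∈) | idx (inj₂ f′) (x , cl-rep i , x∈′)
      ... | b , b≡x | c , c≡f | c′ , c′≡f′ = iso-h₂ b c c′ all
          (λ c≡c′ → f≢f′ (inj₂-injective (trans (sym c≡f) (trans (cong at c≡c′) c′≡f′))))
          (cong labW b≡x) (cong labW c≡f) (cong labW c′≡f′) (fat-nonadj H) (adj-sym H) (adj-irrefl H b)
          (trans (cong₂ adjW b≡x c≡f) x∈) (trans (cong₂ adjW b≡x c′≡f′) x∈′)
        where
        member : ∀ w → InW i w → w ≡ inj₁ x ⊎ w ≡ inj₂ f ⊎ w ≡ inj₂ f′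
        member (inj₁ y) q = inj₁ (cong inj₁ (double-class f≢f′ x∈ x∈′ (path q)))
        member (inj₂ f″) (y , q , y∈) rewrite double-class f≢f′ x∈ x∈′ (path q) with at-most-two f≢f′ x∈ x∈′ y∈
        ... | inj₁ eq = inj₂ (inj₁ (cong inj₂ eq))
        ... | inj₂ eq = inj₂ (inj₂ (cong inj₂ eq))
        all : ∀ d → d ≡ b ⊎ d ≡ c ⊎ d ≡ c′
        all d with member (at d) (at-sound d)
        ... | inj₁ eq = inj₁ (at-inj (trans eq (sym b≡x)))
        ... | inj₂ (inj₁ eq) = inj₂ (inj₁ (at-inj (trans eq (sym c≡f))))
        ... | inj₂ (inj₂ eq) = inj₂ (inj₂ (at-inj (trans eq (sym c′≡f′))))

    module Single {f} (o : Only x f) where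
      class-only : ∀ {y} → cl y ≡ i → Only y f
      class-only c = only-class o (path c)

      cone : Cone H
      cone with idx (inj₂ f) (x , cl-rep i , proj₁ o)
      ... | t , t≡f = record
        { top = t ; top-fat = cong labW t≡f
        ; fat-unique = λ {b} l → at-inj (trans (fat-is-f (at b) (at-sound b) l) (sym t≡f))
        ; top-adj = λ {b} l → trans (cong (adjW (at b)) t≡f) (slim-on-f (at b) (at-sound b) l) }
        where
        fat-is-f : ∀ w → InW i w → labW w ≡ fat → w ≡ inj₂ f
        fat-is-f (inj₂ f′) (y , c , y∈) _ = cong inj₂ (proj₂ (class-only c) f′ y∈)
        slim-on-f : ∀ w → InW i w → labW w ≡ slim → adjW w (inj₂ f) ≡ true
        slim-on-f (inj₁ y) c _ = proj₁ (class-only c)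

      lift : ∀ {b c y z} → Star CoAdj y z → at b ≡ inj₁ y → at c ≡ inj₁ z → Star (CoAdjacent H) b c
      lift ε b≡y c≡y rewrite at-inj (trans b≡y (sym c≡y)) = ε
      lift {b} ((y≢w , y≁w , r) ◅ p) b≡y c≡z
        with idx (inj₁ _) (trans (sym (cl-sound ((y≢w , y≁w , r) ◅ ε))) (subst (InW i) b≡y (at-sound b)))
      ... | d , d≡w = (cong labW d≡w , trans (cong₂ adjW b≡y d≡w) y≁w) ◅ lift p d≡w c≡z

      co-connected : ∀ {b c} → label (lab H) b ≡ slim → label (lab H) c ≡ slim → Star (CoAdjacent H) b c
      co-connected {b} {c} lb lc with slim-inv lb | slim-inv lc
      ... | y , b≡y | z , c≡z = lift (cl-exact (trans (subst (InW i) b≡y (at-sound b))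
                                                  (sym (subst (InW i) c≡z (at-sound c))))) b≡y c≡z

      -- With a second line excluded, `full` gives a non-neighbour of `x` on `f`, which belongs to
      -- the same class.
      two-slim : 2 ≤ numSlim H
      two-slim with full x f (proj₁ o)
      ... | inj₁ (f′ , f′≢f , x∈′) = ⊥-elim (f′≢f (proj₂ o f′ x∈′))
      ... | inj₂ (y , y≢x , y∈ , x≁y)
        with idx (inj₁ x) (cl-rep i)
           | idx (inj₁ y) (trans (sym (cl-sound ((y≢x ∘ sym , x≁y , f , proj₁ o , y∈) ◅ ε))) (cl-rep i))
      ... | b , b≡x | c , c≡y = distinct-count≥2 (λ b≡c → y≢x (inj₁-injective (trans (sym c≡y) (trans (sym (cong at b≡c)) b≡x))))
                                  (cong (isSlim ∘ labW) b≡x) (cong (isSlim ∘ labW) c≡y)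

      inO : InO H
      inO = inj₂ (co-connected⇒indecomposable cone co-connected
                 , (λ b l → top , top-adj l , top-fat)
                 , two-slim
                 , unique-count≡1 {z = top} (cong isFat top-fat) (λ l → fat-unique (isFat-true l)))
        where open Cone cone

      open Embedding (emb x f o)

      -- Follows a co-path from `x`: each vertex stays on `f` by `only-class`, and `closed` then
      -- keeps it in the block.
      block : ∀ {y} → cl y ≡ i → Block y
      block c = go o base (path c)
        where
        go : ∀ {y z} → Only y f → Block y → Star CoAdj y z → Block z
        go oy b ε = b
        go oy b (s@(y≢w , y≁w , _) ◅ p) =
          let ow = only-class oy (s ◅ ε) in go ow (closed b (proj₁ oy) (proj₁ ow) y≢w y≁w) p

      ψ : ∀ w → InW i w → Fin (V host)
      ψ (inj₁ y) c = φ y (block c)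
      ψ (inj₂ _) _ = apex

      ψ-lab : ∀ w q → label (lab host) (ψ w q) ≡ labW w
      ψ-lab (inj₁ y) c = φ-slim (block c)
      ψ-lab (inj₂ _) _ = apex-fat

      ψ-adj : ∀ w w′ q q′ → adj (lab host) (ψ w q) (ψ w′ q′) ≡ adjW w w′
      ψ-adj (inj₁ y) (inj₁ z) c c′ = φ-adj (block c) (block c′)
      ψ-adj (inj₁ y) (inj₂ f′) c (z , c′ , z∈) rewrite proj₂ (class-only c′) f′ z∈ =
        trans (φ-apex (block c)) (sym (proj₁ (class-only c)))
      ψ-adj (inj₂ f′) (inj₁ y) (z , c′ , z∈) c rewrite proj₂ (class-only c′) f′ z∈ =
        trans (adj-sym host _ _) (trans (φ-apex (block c)) (sym (proj₁ (class-only c))))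
      ψ-adj (inj₂ _) (inj₂ _) _ _ = fat-nonadj host _ _ apex-fat apex-fat

      ψ-inj : ∀ w w′ q q′ → ψ w q ≡ ψ w′ q′ → w ≡ w′
      ψ-inj (inj₁ y) (inj₁ z) c c′ eq = cong inj₁ (φ-inj (block c) (block c′) eq)
      ψ-inj (inj₁ y) (inj₂ _) c _ eq = ⊥-elim (slim≢fat (φ-slim (block c)) (trans (cong (label (lab host)) eq) apex-fat))
      ψ-inj (inj₂ _) (inj₁ y) _ c eq =
        ⊥-elim (slim≢fat (φ-slim (block c)) (trans (cong (label (lab host)) (sym eq)) apex-fat))
      ψ-inj (inj₂ f₁) (inj₂ f₂) (y , c , y∈) (z , c′ , z∈) _ =
        cong inj₂ (trans (proj₂ (class-only c) f₁ y∈) (sym (proj₂ (class-only c′) f₂ z∈)))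

      into-host : SubHG host
      into-host = record
        { m = V H
        ; ι = λ b → ψ (at b) (at-sound b)
        ; ι-inj = λ b c eq → at-inj (ψ-inj (at b) (at c) (at-sound b) (at-sound c) eq)
        ; fatNb = λ b l → let c , e , l′ = fat-slimNb H b (trans (sym (ψ-lab (at b) (at-sound b))) l) in
            c , trans (ψ-adj (at b) (at c) (at-sound b) (at-sound c)) e , trans (ψ-lab (at c) (at-sound c)) l′
        }

      in-closure : closure ℋ H
      in-closure = inj₂ (inO , host , host∈ℋ , into-host , record
        { to = λ b → b ; from = λ b → b ; to-from = λ _ → refl ; from-to = λ _ → refl
        ; adj-pres = λ b c → ψ-adj (at b) (at c) (at-sound b) (at-sound c)
        ; lab-pres = λ b → ψ-lab (at b) (at-sound b) })

    H∈closure : closure ℋ H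
    H∈closure with some-line x
    ... | f , x∈ with any? (λ f′ → ¬? (f ≟ f′) ×-dec (on x f′ Bool.≟ true))
    ... | yes (f′ , f≢f′ , x∈′) = inj₁ (Double.is-h₂ f≢f′ x∈ x∈′)
    ... | no none = Single.in-closure (x∈ , only)
      where
      only : ∀ f′ → x ∈ f′ → f′ ≡ f
      only f′ x∈′ with f ≟ f′
      ... | yes eq = sym eq
      ... | no ne = ⊥-elim (none (f′ , ne , x∈′))

  strict-cover : StrictCover (closure ℋ) g
  strict-cover = record
    { cov = record
      { hc = graph ; k = classes ; part = pt ; isSum = is-sum
      ; partInℋ = λ i → Part.H i , Part.H∈closure i , id-iso _
      ; e = λ x → jn (inj₁ x)
      ; e-inj = λ x y eq → inj₁-injective (trans (sym (sp-jn (inj₁ x))) (trans (cong sp eq) (sp-jn (inj₁ y))))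
      ; e-adj = λ x y → cong₂ adjW (sp-jn (inj₁ x)) (sp-jn (inj₁ y))
      ; e-lab = λ x → trans (cong labW (sp-jn (inj₁ x))) (sym (g-slim x))
      }
    ; strict = λ u l → let x , u≡x = slim-inv l in
        x , splitAt-injective (V g) (trans (sp-jn (inj₁ x)) (sym u≡x))
    }

  meets-line : ∀ {x f} → x ∈ f →
               isFat (labW (sp (jn (inj₂ f)))) ∧ adjW (sp (jn (inj₁ x))) (sp (jn (inj₂ f))) ≡ true
  meets-line {x} {f} x∈ rewrite sp-jn (inj₂ f) | sp-jn (inj₁ x) = x∈

  common-meets : ∀ {x y z u} → isFat (labW (sp u)) ∧ adjW (sp (jn (inj₁ x))) (sp u) ≡ true →
                 isFat (labW (sp u)) ∧ adjW (sp (jn (inj₁ y))) (sp u) ≡ true →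
                 isFat (labW (sp u)) ∧ adjW (sp (jn (inj₁ z))) (sp u) ≡ true → Coll L x y z
  common-meets {x} {y} {z} {u} p q r rewrite sp-jn (inj₁ x) | sp-jn (inj₁ y) | sp-jn (inj₁ z) with sp u
  ... | inj₂ f = f , p , q , r

-- Covers as line systems

-- The `isFat` factor turns slim vertices of the cover into empty lines, so that all its vertices
-- can serve as line indices.
meets : ∀ {ℋ g} (C : Cover ℋ g) → Fin (V g) → Fin (V (hc C)) → Bool
meets C x f = isFat (label (lab (hc C)) f) ∧ adj (lab (hc C)) (e C x) f

Collinear : ∀ {ℋ g} (C : Cover ℋ g) → Fin (V g) → Fin (V g) → Fin (V g) → Set
Collinear C x y z = ∃[ f ] (meets C x f ≡ true × meets C y f ≡ true × meets C z f ≡ true)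

iso-trans : ∀ {G G′ G″} → Iso G G′ → Iso G′ G″ → Iso G G″
iso-trans I J = record
  { to = to J ∘ to I ; from = from I ∘ from J
  ; to-from = λ y → trans (cong (to J) (to-from I _)) (to-from J y)
  ; from-to = λ x → trans (cong (from I) (from-to J _)) (from-to I x)
  ; adj-pres = λ x y → trans (adj-pres J _ _) (adj-pres I x y)
  ; lab-pres = λ x → trans (lab-pres J _) (lab-pres I x) }

iso-sym : ∀ {G G′} → Iso G G′ → Iso G′ G
iso-sym {G} {G′} I = record
  { to = from I ; from = to I ; to-from = from-to I ; from-to = to-from I
  ; adj-pres = λ x y → trans (sym (adj-pres I _ _)) (cong₂ (adj G′) (to-from I x) (to-from I y))
  ; lab-pres = λ x → trans (sym (lab-pres I _)) (cong (label G′) (to-from I x)) }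

module _ {h : HoffmanGraph} (s : SubHG h) where
  private
    slim-at fat-at : Fin (m s) → Set
    slim-at b = label (lab h) (ι s b) ≡ slim
    fat-at  b = label (lab h) (ι s b) ≡ fat

  -- What the line system uses of a part isomorphic to `h₂`.
  record EdgePart : Set where
    field
      end₁ end₂   : Fin (m s)
      end₁-fat    : fat-at end₁
      end₂-fat    : fat-at end₂
      ends-differ : end₁ ≢ end₂
      ends        : ∀ {b} → fat-at b → b ≡ end₁ ⊎ b ≡ end₂
      slim-unique : ∀ {b c} → slim-at b → slim-at c → b ≡ c
      adj₁        : ∀ {b} → slim-at b → adj (lab h) (ι s b) (ι s end₁) ≡ true
      adj₂        : ∀ {b} → slim-at b → adj (lab h) (ι s b) (ι s end₂) ≡ true

  -- The same for every other part: `partner` expresses its indecomposability, and `χ` embeds it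
  -- into a member of `ℋ`.
  record BlockPart (ℋ : Family) : Set where
    field
      cone    : Cone (inducedHG s)
      partner : ∀ {b} → slim-at b → ∃[ c ] (c ≢ b × slim-at c × adj (lab h) (ι s b) (ι s c) ≡ false)
      host    : HoffmanGraph
      host∈ℋ  : ℋ host
      χ       : Fin (m s) → Fin (V host)
      χ-inj   : ∀ {b c} → χ b ≡ χ c → b ≡ c
      χ-lab   : ∀ b → label (lab host) (χ b) ≡ label (lab h) (ι s b)
      χ-adj   : ∀ b c → adj (lab host) (χ b) (χ c) ≡ adj (lab h) (ι s b) (ι s c)

  edgePart : Iso (induced s) h₂ → EdgePart
  edgePart I = record
    { end₁ = from I (suc zero) ; end₂ = from I (suc (suc zero))
    ; end₁-fat = from-lab (suc zero) ; end₂-fat = from-lab (suc (suc zero))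
    ; ends-differ = λ eq → differ (trans (sym (to-from I _)) (trans (cong (to I) eq) (to-from I _)))
    ; ends = λ {b} l → two (trans (lab-pres I b) l) (from-to I b)
    ; slim-unique = λ {b} {c} l l′ → trans (sym (from-to I b)) (trans (cong (from I)
        (trans (is-zero (trans (lab-pres I b) l)) (sym (is-zero (trans (lab-pres I c) l′))))) (from-to I c))
    ; adj₁ = λ l → adj-end zero l
    ; adj₂ = λ l → adj-end (suc zero) l }
    where
    differ : _≢_ {A = Fin 3} (suc zero) (suc (suc zero))
    differ ()
    from-lab : ∀ i → label (lab h) (ι s (from I i)) ≡ h₂lab i
    from-lab = lab-pres (iso-sym I)
    is-zero : ∀ {i} → h₂lab i ≡ slim → i ≡ zero
    is-zero {zero} _ = refl
    two : ∀ {i b} → h₂lab i ≡ fat → from I i ≡ b → b ≡ from I (suc zero) ⊎ b ≡ from I (suc (suc zero))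
    two {suc zero} _ eq = inj₁ (sym eq)
    two {suc (suc zero)} _ eq = inj₂ (sym eq)
    adj-end : ∀ i {b} → slim-at b → adj (lab h) (ι s b) (ι s (from I (suc i))) ≡ true
    adj-end i {b} l = trans (sym (adj-pres I b _))
      (cong₂ h₂adj (is-zero (trans (lab-pres I b) l)) (to-from I (suc i)))

  blockPart : ∀ {ℋ h₀ host} → Iso (induced s) (lab h₀) →
              Indecomposable h₀ → IsFatHG h₀ → 2 ≤ numSlim h₀ → numFat h₀ ≡ 1 →
              ℋ host → (t : SubHG host) → Iso (lab h₀) (induced t) → BlockPart ℋ
  blockPart {ℋ} {h₀} {host} I indec isfat 2≤ one host∈ t J = record
    { cone = record
      { top = from I top
      ; top-fat = trans (lab-pres (iso-sym I) top) top-fat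
      ; fat-unique = λ {b} l → trans (sym (from-to I b)) (cong (from I) (fat-unique (trans (lab-pres I b) l)))
      ; top-adj = λ {b} l → trans (sym (adj-pres I b _))
          (trans (cong (adj (lab h₀) (to I b)) (to-from I top)) (top-adj (trans (lab-pres I b) l))) }
    ; partner = partner
    ; host = host ; host∈ℋ = host∈
    ; χ = λ b → ι t (to K b)
    ; χ-inj = λ {b} {c} eq → trans (sym (from-to K b)) (trans (cong (from K) (ι-inj t _ _ eq)) (from-to K c))
    ; χ-lab = lab-pres K
    ; χ-adj = adj-pres K }
    where
    K = iso-trans I J
    cone₀ : Cone h₀
    cone₀ with count-pos⁻¹ {p = λ z → isFat (label (lab h₀) z)} (subst (1 ≤_) (sym one) ≤-refl)
    ... | z , zf = record
      { top = z ; top-fat = isFat-true zf ; fat-unique = unique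
      ; top-adj = λ {v} l → let y , e , l′ = isfat v l in subst (λ u → adj (lab h₀) v u ≡ true) (unique l′) e }
      where
      unique : ∀ {v} → label (lab h₀) v ≡ fat → v ≡ z
      unique l = count≤1-unique {p = λ z → isFat (label (lab h₀) z)} (subst (_≤ 1) (sym one) ≤-refl) (cong isFat l) zf
    open Cone cone₀
    partner : ∀ {b} → slim-at b → ∃[ c ] (c ≢ b × slim-at c × adj (lab h) (ι s b) (ι s c) ≡ false)
    partner {b} l with nonadjacent-partner cone₀ indec 2≤ (trans (lab-pres I b) l)
    ... | c , c≢b , lc , e = from I c
      , (λ { refl → c≢b (sym (to-from I c)) })
      , trans (lab-pres (iso-sym I) c) lc
      , trans (sym (adj-pres I b _)) (trans (cong (adj (lab h₀) (to I b)) (to-from I c)) e)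

  classify : ∀ {ℋ} → induced s ∈F closure ℋ → EdgePart ⊎ BlockPart ℋ
  classify (h₀ , inj₁ J , I) = inj₁ (edgePart (iso-trans I J))
  classify (h₀ , inj₂ (inj₁ J , _) , I) = inj₁ (edgePart (iso-trans I J))
  classify (h₀ , inj₂ (inj₂ (indec , isfat , 2≤ , one) , host , host∈ , t , J) , I) =
    inj₂ (blockPart I indec isfat 2≤ one host∈ t J)

module CoverLines {ℋ : Family} {g : HoffmanGraph} (g-slim : IsSlimGraph g) (C : Cover (closure ℋ) g) where
  private
    h = hc C
  open IsSum (isSum C)

  kind : ∀ i → EdgePart (part C i) ⊎ BlockPart (part C i) ℋ
  kind i = classify (part C i) (partInℋ C i)

  e-slim : ∀ x → label (lab h) (e C x) ≡ slim
  e-slim x = trans (e-lab C x) (g-slim x)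

  In : Fin (V g) → Fin (k C) → Set
  In x i = _∈V_ {h} (e C x) (part C i)

  index : ∀ x → ∃[ i ] In x i
  index x = slimCover (e C x) (e-slim x)

  meets-intro : ∀ {x f} → label (lab h) f ≡ fat → adj (lab h) (e C x) f ≡ true → meets C x f ≡ true
  meets-intro l a = ∧-intro (cong isFat l) a

  meets-fat : ∀ {x f} → meets C x f ≡ true → label (lab h) f ≡ fat
  meets-fat p = isFat-true (∧-conicalˡ _ _ p)

  meets-adj : ∀ {x f} → meets C x f ≡ true → adj (lab h) (e C x) f ≡ true
  meets-adj p = ∧-conicalʳ _ _ p

  meets-in : ∀ {x f i} → In x i → meets C x f ≡ true → _∈V_ {h} f (part C i)
  meets-in {x} {f} {i} x∈ p = fatNbIn i (e C x) x∈ (e-slim x) f (meets-fat {x} p) (meets-adj p)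

  isCommon : Fin (V g) → Fin (V g) → Fin (V h) → Bool
  isCommon x y f = isFat (label (lab h) f) ∧ (adj (lab h) (e C x) f ∧ adj (lab h) (e C y) f)

  common-intro : ∀ {x y f} → meets C x f ≡ true → meets C y f ≡ true → isCommon x y f ≡ true
  common-intro {x} p q = ∧-intro (cong isFat (meets-fat {x} p)) (∧-intro (meets-adj p) (meets-adj q))

  common-elim : ∀ x y f → isCommon x y f ≡ true → meets C x f ≡ true × meets C y f ≡ true
  common-elim x y f p with isFat (label (lab h) f) | adj (lab h) (e C x) f
  ... | true | true = refl , p

  cross-meet : ∀ {x y i j f f′} → In x i → In y j → i ≢ j → meets C x f ≡ true → meets C y f ≡ true →
               meets C x f′ ≡ true → meets C y f′ ≡ true → f ≡ f′
  cross-meet {x} {y} x∈ y∈ i≢j p q p′ q′ =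
    count≤1-unique (cross≤1 _ _ i≢j (e C x) (e C y) x∈ y∈ (e-slim x) (e-slim y))
      (common-intro {x} {y} p q) (common-intro {x} {y} p′ q′)

  cross-adj : ∀ {x y i j f} → In x i → In y j → i ≢ j → meets C x f ≡ true → meets C y f ≡ true →
              adj (lab g) x y ≡ true
  cross-adj {x} {y} x∈ y∈ i≢j p q = trans (sym (e-adj C x y))
    (Equivalence.to (cross≡1 _ _ i≢j (e C x) (e C y) x∈ y∈ (e-slim x) (e-slim y))
      (≤-antisym (cross≤1 _ _ i≢j (e C x) (e C y) x∈ y∈ (e-slim x) (e-slim y)) (count-pos {p = isCommon x y} _ (common-intro {x} {y} p q))))

  cross-join : ∀ {x y i j} → In x i → In y j → i ≢ j → adj (lab g) x y ≡ true →
               ∃[ f ] (meets C x f ≡ true × meets C y f ≡ true)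
  cross-join {x} {y} x∈ y∈ i≢j a
    with count-pos⁻¹ {p = isCommon x y} (subst (1 ≤_) (sym (Equivalence.from
           (cross≡1 _ _ i≢j (e C x) (e C y) x∈ y∈ (e-slim x) (e-slim y)) (trans (e-adj C x y) a))) ≤-refl)
  ... | f , p = f , common-elim x y f p

  module InEdge {i} (E : EdgePart (part C i)) where
    open EdgePart E
    private
      ep = part C i

    same-point : ∀ {x y} → In x i → In y i → x ≡ y
    same-point {x} {y} (b , b≡x) (c , c≡y) = e-inj C x y (trans (sym b≡x) (trans (cong (ι ep)
      (slim-unique (trans (cong (label (lab h)) b≡x) (e-slim x)) (trans (cong (label (lab h)) c≡y) (e-slim y)))) c≡y))

    line₁ line₂ : Fin (V h)
    line₁ = ι ep end₁
    line₂ = ι ep end₂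

    lines-differ : line₁ ≢ line₂
    lines-differ eq = ends-differ (ι-inj ep _ _ eq)

    on₁ : ∀ {x} → In x i → meets C x line₁ ≡ true
    on₁ {x} (b , b≡x) = meets-intro {x} end₁-fat
      (subst (λ v → adj (lab h) v line₁ ≡ true) b≡x (adj₁ (trans (cong (label (lab h)) b≡x) (e-slim x))))

    on₂ : ∀ {x} → In x i → meets C x line₂ ≡ true
    on₂ {x} (b , b≡x) = meets-intro {x} end₂-fat
      (subst (λ v → adj (lab h) v line₂ ≡ true) b≡x (adj₂ (trans (cong (label (lab h)) b≡x) (e-slim x))))

    its-lines : ∀ {x f} → In x i → meets C x f ≡ true → f ≡ line₁ ⊎ f ≡ line₂
    its-lines {x} x∈ p with meets-in x∈ p
    ... | b , refl with ends (meets-fat {x} p)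
    ... | inj₁ eq = inj₁ (cong (ι ep) eq)
    ... | inj₂ eq = inj₂ (cong (ι ep) eq)

    other-line : ∀ {x f} → In x i → meets C x f ≡ true → ∃[ f′ ] (f′ ≢ f × meets C x f′ ≡ true)
    other-line x∈ p with its-lines x∈ p
    ... | inj₁ refl = line₂ , lines-differ ∘ sym , on₂ x∈
    ... | inj₂ refl = line₁ , lines-differ , on₁ x∈

    two-lines : ∀ {x f f′ f″} → In x i → f ≢ f′ → meets C x f ≡ true → meets C x f′ ≡ true → meets C x f″ ≡ true →
                f″ ≡ f ⊎ f″ ≡ f′
    two-lines x∈ f≢f′ p p′ p″ with its-lines x∈ p | its-lines x∈ p′ | its-lines x∈ p″
    ... | inj₁ refl | inj₁ refl | _ = ⊥-elim (f≢f′ refl)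
    ... | inj₁ refl | inj₂ refl | eq = eq
    ... | inj₂ refl | inj₁ refl | inj₁ eq = inj₂ eq
    ... | inj₂ refl | inj₁ refl | inj₂ eq = inj₁ eq
    ... | inj₂ refl | inj₂ refl | _ = ⊥-elim (f≢f′ refl)

  module InBlock {i} (B : BlockPart (part C i) ℋ) where
    open BlockPart B
    open Cone cone
    private
      bp = part C i

    line : Fin (V h)
    line = ι bp top

    on-line : ∀ {x} → In x i → meets C x line ≡ true
    on-line {x} (b , b≡x) = meets-intro {x} top-fat
      (subst (λ v → adj (lab h) v line ≡ true) b≡x (top-adj (trans (cong (label (lab h)) b≡x) (e-slim x))))

    its-line : ∀ {x f} → In x i → meets C x f ≡ true → f ≡ line
    its-line {x} x∈ p with meets-in x∈ p
    ... | b , refl = cong (ι bp) (fat-unique (meets-fat {x} p))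

    same-line : ∀ {x f f′} → In x i → meets C x f ≡ true → meets C x f′ ≡ true → f ≡ f′
    same-line x∈ p p′ = trans (its-line x∈ p) (sym (its-line x∈ p′))

  -- For points in different parts the axioms are the cross conditions of the sum. Inside one part,
  -- an `h₂` has no two distinct points, and a block has only one line.
  lines : Lines (adj (lab g)) (Fin (V h))
  lines = record
    { on = meets C
    ; some-line = some
    ; join-line = joined _ _
    ; meet-unique = met
    ; double-adj = λ f≢f′ p p′ x≢y q → double f≢f′ p p′ x≢y q
    ; at-most-two = two
    }
    where
    some : ∀ x → ∃[ f ] (meets C x f ≡ true)
    some x with index x
    ... | i , x∈ with kind i
    ... | inj₁ E = InEdge.line₁ E , InEdge.on₁ E x∈
    ... | inj₂ B = InBlock.line B , InBlock.on-line B x∈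
    joined : ∀ x y → adj (lab g) x y ≡ true → ∃[ f ] (meets C x f ≡ true × meets C y f ≡ true)
    joined x y a with index x | index y
    ... | i , x∈ | j , y∈ with i ≟ j
    ... | no i≢j = cross-join x∈ y∈ i≢j a
    ... | yes refl with kind i
    ... | inj₁ E with InEdge.same-point E x∈ y∈
    ...   | refl = ⊥-elim (true≢false a (adj-irrefl g x))
    joined x y a | i , x∈ | j , y∈ | yes refl | inj₂ B = InBlock.line B , InBlock.on-line B x∈ , InBlock.on-line B y∈
    met : ∀ {x y f f′} → x ≢ y → meets C x f ≡ true → meets C y f ≡ true →
          meets C x f′ ≡ true → meets C y f′ ≡ true → f ≡ f′
    met {x} {y} x≢y p q p′ q′ with index x | index y
    ... | i , x∈ | j , y∈ with i ≟ j
    ... | no i≢j = cross-meet x∈ y∈ i≢j p q p′ q′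
    ... | yes refl with kind i
    ... | inj₁ E = ⊥-elim (x≢y (InEdge.same-point E x∈ y∈))
    ... | inj₂ B = InBlock.same-line B x∈ p p′
    double : ∀ {x y f f′} → f ≢ f′ → meets C x f ≡ true → meets C x f′ ≡ true → x ≢ y → meets C y f ≡ true →
             adj (lab g) x y ≡ true
    double {x} {y} f≢f′ p p′ x≢y q with index x | index y
    ... | i , x∈ | j , y∈ with i ≟ j
    ... | no i≢j = cross-adj x∈ y∈ i≢j p q
    ... | yes refl with kind i
    ... | inj₁ E = ⊥-elim (x≢y (InEdge.same-point E x∈ y∈))
    ... | inj₂ B = ⊥-elim (f≢f′ (InBlock.same-line B x∈ p p′))
    two : ∀ {x f f′ f″} → f ≢ f′ → meets C x f ≡ true → meets C x f′ ≡ true → meets C x f″ ≡ true →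
          f″ ≡ f ⊎ f″ ≡ f′
    two {x} f≢f′ p p′ p″ with index x
    ... | i , x∈ with kind i
    ... | inj₁ E = InEdge.two-lines E x∈ f≢f′ p p′ p″
    ... | inj₂ B = ⊥-elim (f≢f′ (InBlock.same-line B x∈ p p′))

  full : Strict C → Full lines
  full str x f p with index x
  ... | i , x∈ with kind i
  ... | inj₁ E = inj₁ (InEdge.other-line E x∈ p)
  ... | inj₂ B with x∈
  ... | b , b≡x with BlockPart.partner B (trans (cong (label (lab h)) b≡x) (e-slim x))
  -- The non-neighbour `c` lives in the cover; strictness makes it a point of `g`.
  ... | c , c≢b , lc , b≁c with str (ι (part C i) c) lc
  ... | y , y≡c = inj₂ (y , (λ { refl → c≢b (ι-inj (part C i) _ _ (trans (sym y≡c) (sym b≡x))) })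
                      , subst (λ f → meets C y f ≡ true) (sym (InBlock.its-line B x∈ p)) (InBlock.on-line B (c , sym y≡c))
                      , trans (sym (e-adj C x y)) (trans (cong₂ (adj (lab h)) (sym b≡x) y≡c) b≁c))

  -- A point with only one line lies in a block part, whose points serve as `Block`. They are closed
  -- because points of different parts on a common line are adjacent.
  embedded : Embedded ℋ lines
  embedded x f (p , only) with index x
  ... | i , x∈ with kind i
  ... | inj₁ E = let f′ , f′≢f , p′ = InEdge.other-line E x∈ p in ⊥-elim (f′≢f (only f′ p′))
  ... | inj₂ B = record
    { host = host ; host∈ℋ = host∈ℋ
    ; Block = λ y → In y i
    ; base = x∈
    ; closed = closed
    ; φ = λ y (b , _) → χ b
    ; apex = χ top
    ; φ-slim = λ {y} (b , b≡y) → trans (χ-lab b) (trans (cong (label (lab h)) b≡y) (e-slim y))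
    ; apex-fat = trans (χ-lab top) top-fat
    ; φ-inj = λ {y} {z} (b , b≡y) (c , c≡z) eq →
        e-inj C y z (trans (sym b≡y) (trans (cong (ι (part C i)) (χ-inj eq)) c≡z))
    ; φ-adj = λ {y} {z} (b , b≡y) (c , c≡z) → trans (χ-adj b c) (trans (cong₂ (adj (lab h)) b≡y c≡z) (e-adj C y z))
    ; φ-apex = λ {y} (b , b≡y) → trans (χ-adj b top) (top-adj (trans (cong (label (lab h)) b≡y) (e-slim y)))
    }
    where
    open BlockPart B
    open Cone cone
    closed : ∀ {y z} → In y i → meets C y f ≡ true → meets C z f ≡ true → y ≢ z → adj (lab g) y z ≡ false → In z i
    closed {y} {z} y∈ q r _ y≁z with index z
    ... | j , z∈ with i ≟ j
    ... | yes refl = z∈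
    ... | no i≢j = ⊥-elim (true≢false (cross-adj y∈ z∈ i≢j q r) y≁z)

-- Making a cover strict

module Strictification {ℋ : Family} {g : HoffmanGraph} (g-slim : IsSlimGraph g) (C : Cover (closure ℋ) g) where
  private
    v = V (hc C)
    module C = CoverLines g-slim C
    module P = Pendants C.lines

    line : Fin (v ℕ.+ V g) → Fin v ⊎ Fin (V g)
    line = splitAt v

    NonEmpty : Fin (v ℕ.+ V g) → Set
    NonEmpty u = ∃[ x ] (P.on⁺ x (line u) ≡ true)

    module E = Enumeration (enumerate {Q = NonEmpty} (λ u → any? (λ x → P.on⁺ x (line u) Bool.≟ true)))

    hits : ∀ {x f} → P.on⁺ x f ≡ true → ∃[ u ] (line (E.elem u) ≡ f)
    hits {x} {f} p with E.complete (x , trans (cong (P.on⁺ x) (splitAt-join v (V g) f)) p)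
    ... | u , eq = u , trans (cong line eq) (splitAt-join v (V g) f)

    -- Taking lines on the points of `g` has forgotten the other slim vertices; pendants restore
    -- `Full`, empty lines go, and the result is realised.
    module R = Reindex P.lines⁺ (λ u → line (E.elem u)) (λ eq → E.injective _ _ (splitAt-injective v eq)) hits
    module S = Realisation ℋ g g-slim R.reindexed E.sound (R.full-reindexed P.full⁺)
                 (R.embedded-reindexed (P.embedded⁺ C.embedded))

  strictified : StrictCover (closure ℋ) g
  strictified = S.strict-cover

  strictified-coll : ∀ {x y z} → Collinear C x y z → Collinear (cov strictified) x y z
  strictified-coll c with R.coll-reindexed (P.coll⁺ c)
  ... | f , x∈ , y∈ , z∈ = S.jn (inj₂ f) , S.meets-line x∈ , S.meets-line y∈ , S.meets-line z∈

  -- Two distinct points rule out a pendant as their common line.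
  strictified-coll⁻¹ : ∀ {x y z} → x ≢ y → Collinear (cov strictified) x y z → Collinear C x y z
  strictified-coll⁻¹ {x} {y} {z} x≢y (u , px , py , pz) =
    P.coll⁺⁻¹ x≢y (R.coll-reindexed⁻¹ (S.common-meets px py pz))

-- Restriction to a vertex-deleted subgraph

module _ (g : HoffmanGraph) (g-slim : IsSlimGraph g) {m} (j : Fin m → Fin (V g)) (j-inj : ∀ x y → j x ≡ j y → x ≡ y) where

  subgraph : HoffmanGraph
  subgraph = record
    { lab = record { n = m ; adj = λ x y → adj (lab g) (j x) (j y) ; label = λ x → label (lab g) (j x) }
    ; adj-sym = λ x y → adj-sym g (j x) (j y)
    ; adj-irrefl = λ x → adj-irrefl g (j x)
    ; fat-nonadj = λ x y → fat-nonadj g (j x) (j y)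
    ; fat-slimNb = λ x l → ⊥-elim (slim≢fat (g-slim (j x)) l)
    }

  restrict : ∀ {ℋ} → Cover ℋ g → Cover ℋ subgraph
  restrict C = record
    { hc = hc C ; k = k C ; part = part C ; isSum = isSum C ; partInℋ = partInℋ C
    ; e = e C ∘ j
    ; e-inj = λ x y eq → j-inj x y (e-inj C (j x) (j y) eq)
    ; e-adj = λ x y → e-adj C (j x) (j y)
    ; e-lab = λ x → e-lab C (j x) }

-- An interface to `punchIn` that hides the equation between the order of `g` and `suc m`, matched
-- once in `deletion`, where the order is a variable.
record Deletion {n m} (v : Fin n) (j : Fin m → Fin n) : Set where
  field
    j-inj    : ∀ x y → j x ≡ j y → x ≡ y
    j-avoids : ∀ x → j x ≢ v
    j-onto   : ∀ {y} → y ≢ v → ∃[ x ] (j x ≡ y)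

deletion : ∀ {n m} → n ≡ suc m → (v : Fin n) → Σ (Fin m → Fin n) (Deletion v)
deletion refl v = punchIn v , record
  { j-inj = λ x y → Fin.punchIn-injective v x y
  ; j-avoids = λ x → Fin.punchInᵢ≢i v x
  ; j-onto = λ y≢v → punchOut (y≢v ∘ sym) , Fin.punchIn-punchOut (y≢v ∘ sym) }

star⇒reach : ∀ {g m} (g-slim : IsSlimGraph g) {v} {j : Fin m → Fin (V g)} (D : Deletion v j) {p q} →
             Star (Avoiding (adj (lab g)) v) p q → ∀ {x y} → j x ≡ p → j y ≡ q →
             Reach (lab (subgraph g g-slim j (Deletion.j-inj D))) x y
star⇒reach g-slim D ε x≡p y≡p with Deletion.j-inj D _ _ (trans x≡p (sym y≡p))
... | refl = here
star⇒reach {g} g-slim D ((e , _ , w≢v) ◅ p) refl y≡q with Deletion.j-onto D w≢v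
... | w , refl = step e (star⇒reach {g} g-slim D p refl y≡q)

reach⇒star : ∀ {G x y} → Reach G x y → Star (Edge (adj G)) x y
reach⇒star here       = ε
reach⇒star (step e p) = e ◅ reach⇒star p

-- Equivalence of strict covers

equivalent-coll : ∀ {ℋ g} {c c′ : StrictCover ℋ g} → Equivalent c c′ → ∀ {x y z} →
                  Collinear (cov c) x y z → Collinear (cov c′) x y z
equivalent-coll {c = c} {c′} (I , fix) (f , p , q , r) = to I f , move _ p , move _ q , move _ r
  where
  move : ∀ x → meets (cov c) x f ≡ true → meets (cov c′) x (to I f) ≡ true
  move x p = trans (cong₂ (λ l b → isFat l ∧ b) (lab-pres I f)
    (trans (cong (λ u → adj (lab (hc (cov c′))) u (to I f)) (sym (fix x))) (adj-pres I (e (cov c) x) f))) p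

module Correspondence {ℋ : Family} {g : HoffmanGraph} (g-slim : IsSlimGraph g)
         (connected : ∀ x y → Star (Edge (adj (lab g))) x y) (4≤V : 4 ≤ V g) where
  private
    SC = StrictCover (closure ℋ) g

    graph : SC → LabGraph
    graph c = lab (hc (cov c))

    lines : (c : SC) → Lines (adj (lab g)) (Fin (n (graph c)))
    lines c = CoverLines.lines g-slim (cov c)

    e-slim : (c : SC) → ∀ x → label (graph c) (e (cov c) x) ≡ slim
    e-slim c = CoverLines.e-slim g-slim (cov c)

  SameColl : SC → SC → Set
  SameColl c c′ = ∀ {x y z} → x ≢ y → Collinear (cov c) x y z → Collinear (cov c′) x y z

  -- The graph of the isomorphism to be built. It is total and functional, and being symmetric in
  -- the two covers it is so in both directions; fat vertices correspond when they have the same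
  -- points.
  data Corr (c c′ : SC) : Fin (n (graph c)) → Fin (n (graph c′)) → Set where
    slims : ∀ x → Corr c c′ (e (cov c) x) (e (cov c′) x)
    fats  : ∀ {f f′} → label (graph c) f ≡ fat → label (graph c′) f′ ≡ fat →
            (∀ x → meets (cov c) x f ≡ meets (cov c′) x f′) → Corr c c′ f f′

  point-on : (c : SC) → ∀ {f} → label (graph c) f ≡ fat → ∃[ x ] (meets (cov c) x f ≡ true)
  point-on c {f} l with fat-slimNb (hc (cov c)) f l
  ... | u , a , u-slim with strict c u u-slim
  ... | x , refl = x , ∧-intro (cong isFat l) (trans (adj-sym (hc (cov c)) _ _) a)

  corr-sym : ∀ {c c′ u u′} → Corr c c′ u u′ → Corr c′ c u′ u
  corr-sym (slims x)        = slims x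
  corr-sym (fats l l′ same) = fats l′ l (λ x → sym (same x))

  corr-unique : ∀ {c c′ u u′ v v′} → Corr c c′ u u′ → Corr c c′ v v′ → u ≡ v → u′ ≡ v′
  corr-unique {c} {c′} (slims x) (slims y) eq = cong (e (cov c′)) (e-inj (cov c) x y eq)
  corr-unique {c} (slims x) (fats l _ _) refl = ⊥-elim (slim≢fat (e-slim c x) l)
  corr-unique {c} (fats l _ _) (slims x) refl = ⊥-elim (slim≢fat (e-slim c x) l)
  -- Strictness gives the line a point of `g`, from which `same-points-unique` starts.
  corr-unique {c} {c′} (fats l l′ same) (fats _ _ same′) refl with point-on c′ l′
  ... | x , x∈ = same-points-unique (adj-sym g) (adj-irrefl g) connected 4≤V (lines c′) x∈
                   (λ y → trans (sym (same y)) (same′ y))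

  corr-total : ∀ {c c′} → SameColl c c′ → SameColl c′ c → ∀ u → ∃[ u′ ] Corr c c′ u u′
  corr-total {c} {c′} same same′ u with label (graph c) u in l
  ... | slim with strict c u l
  ...   | x , refl = e (cov c′) x , slims x
  corr-total {c} {c′} same same′ u | fat with point-on c l
  ... | x , x∈ with Matching.match (adj-sym g) (adj-irrefl g) connected 4≤V (lines c) (lines c′)
                      (CoverLines.full g-slim (cov c) (strict c)) (CoverLines.full g-slim (cov c′) (strict c′))
                      same same′ x∈
  ... | f′ , match = f′ , fats l (isFat-true (∧-conicalˡ _ _ (trans (sym (match x)) x∈))) match

  meets-fat : (c : SC) → ∀ x {f} → label (graph c) f ≡ fat → meets (cov c) x f ≡ adj (graph c) (e (cov c) x) f
  meets-fat c x {f} l = cong (λ l → isFat l ∧ adj (graph c) (e (cov c) x) f) l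

  corr-adj : ∀ {c c′ u u′ v v′} → Corr c c′ u u′ → Corr c c′ v v′ → adj (graph c′) u′ v′ ≡ adj (graph c) u v
  corr-adj {c} {c′} (slims x) (slims y) = trans (e-adj (cov c′) x y) (sym (e-adj (cov c) x y))
  corr-adj {c} {c′} (slims x) (fats l l′ same) = trans (sym (meets-fat c′ x l′)) (trans (sym (same x)) (meets-fat c x l))
  corr-adj {c} {c′} (fats l l′ same) (slims x) = trans (adj-sym (hc (cov c′)) _ _)
    (trans (trans (sym (meets-fat c′ x l′)) (trans (sym (same x)) (meets-fat c x l))) (adj-sym (hc (cov c)) _ _))
  corr-adj {c} {c′} (fats l l′ _) (fats r r′ _) =
    trans (fat-nonadj (hc (cov c′)) _ _ l′ r′) (sym (fat-nonadj (hc (cov c)) _ _ l r))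

  corr-lab : ∀ {c c′ u u′} → Corr c c′ u u′ → label (graph c′) u′ ≡ label (graph c) u
  corr-lab {c} {c′} (slims x) = trans (e-slim c′ x) (sym (e-slim c x))
  corr-lab (fats l l′ _) = trans l′ (sym l)

  equivalent : ∀ {c c′} → SameColl c c′ → SameColl c′ c → Equivalent c c′
  equivalent {c} {c′} same same′ = record
    { to = proj₁ ∘ forth
    ; from = proj₁ ∘ back
    ; to-from = λ y → corr-unique (proj₂ (forth (proj₁ (back y)))) (corr-sym (proj₂ (back y))) refl
    ; from-to = λ x → corr-unique (proj₂ (back (proj₁ (forth x)))) (corr-sym (proj₂ (forth x))) refl
    ; adj-pres = λ x y → corr-adj (proj₂ (forth x)) (proj₂ (forth y))
    ; lab-pres = λ x → corr-lab (proj₂ (forth x))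
    } , λ x → corr-unique (proj₂ (forth (e (cov c) x))) (slims x) refl
    where
    forth = corr-total {c} {c′} same same′
    back  = corr-total {c′} {c} same′ same

-- Induction on the order

closure-cover : ∀ {ℋ g} → ℋ ⊆O → Cover ℋ g → Cover (closure ℋ) g
closure-cover {ℋ} ℋ⊆O C = record
  { hc = hc C ; k = k C ; part = part C ; isSum = isSum C ; partInℋ = inClosure
  ; e = e C ; e-inj = e-inj C ; e-adj = e-adj C ; e-lab = e-lab C }
  where
  whole : ∀ h → SubHG h
  whole h = record { m = V h ; ι = λ x → x ; ι-inj = λ _ _ eq → eq ; fatNb = fat-slimNb h }
  -- A member of `ℋ` is a Hoffman subgraph of itself.
  inClosure : ∀ i → induced (part C i) ∈F closure ℋ
  inClosure i with partInℋ C i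
  ... | h , h∈ , I with ℋ⊆O h h∈
  ... | h₀ , h₀∈O , J = h₀ , inj₂ (h₀∈O , h , h∈ , whole h , iso-sym J) , iso-trans I J

module _ (ℋ : Family) (ℋ⊆O : ℋ ⊆O) where

  Unique : ℕ → Set
  Unique N = ∀ g → V g ≡ N → ConnSlimLine ℋ g → UniqueStrictCover (closure ℋ) g

  -- Existence comes from strictifying the given cover; uniqueness from comparing collinear triples
  -- both ways. The bound on `m` gives `g` the four vertices that `fourth-vertex` asks for.
  unique-step : ∀ {m} → 3 ≤ m → Unique m → Unique (suc m)
  unique-step {m} 3≤m unique g V≡ (g-slim , conn , line) =
    Strictification.strictified g-slim (closure-cover ℋ⊆O line)
    , λ c c′ → equivalent {c} {c′} (preserved c c′) (preserved c′ c)
    where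
    connected : ∀ x y → Star (Edge (adj (lab g))) x y
    connected x y = reach⇒star (conn x y)
    4≤V : 4 ≤ V g
    4≤V = subst (4 ≤_) (sym V≡) (s≤s 3≤m)
    open Correspondence {ℋ} g-slim connected 4≤V
    agree : ∀ c c′ v → NonCut (adj (lab g)) v → ∀ {x y z} → x ≢ v → y ≢ v → z ≢ v → x ≢ y →
            Collinear (cov c) x y z → Collinear (cov c′) x y z
    agree c c′ v nc x≢v y≢v z≢v x≢y coll with deletion V≡ v
    ... | j , D with Deletion.j-onto D x≢v | Deletion.j-onto D y≢v | Deletion.j-onto D z≢v
    ... | x , refl | y , refl | z , refl =
      -- Both covers are restricted to `g′`, which is `g` without `v`, and made strict there.
      -- Uniqueness for order `m` identifies the results, and the triple is carried along.
      S′.strictified-coll⁻¹ (x≢y ∘ cong j) (equivalent-coll {c = S.strictified} {S′.strictified}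
        (proj₂ (unique g′ refl (g′-slim , g′-conn , restrict g g-slim j j-inj line)) S.strictified S′.strictified)
        (S.strictified-coll {x} {y} {z} coll))
      where
      open Deletion D
      g′ = subgraph g g-slim j j-inj
      g′-slim : IsSlimGraph g′
      g′-slim x = g-slim (j x)
      g′-conn : Connected g′
      g′-conn x y = star⇒reach {g} g-slim D (nc (j-avoids x) (j-avoids y)) refl refl
      module S = Strictification g′-slim (restrict g g-slim j j-inj (cov c))
      module S′ = Strictification g′-slim (restrict g g-slim j j-inj (cov c′))
    preserved : ∀ c c′ → SameColl c c′
    preserved c c′ = Comparison.coll-preserved (adj-sym g) (adj-irrefl g) connected 4≤V
      (CoverLines.lines g-slim (cov c)) (CoverLines.lines g-slim (cov c′)) (agree c c′)

  unique-from : ∀ {N M} → 3 ≤ N → Unique N → N ≤′ M → Unique M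
  unique-from 3≤N unique ≤′-refl = unique
  unique-from 3≤N unique (≤′-step N≤M) = unique-step (≤-trans 3≤N (≤′⇒≤ N≤M)) (unique-from 3≤N unique N≤M)

theorem1p4 : (ℋ : Family) → ℋ ⊆O → h₂ ∈F ℋ → (N : ℕ) → 7 ≤ N →
    (∀ g → V g ≡ N → ConnSlimLine ℋ g → UniqueStrictCover (closure ℋ) g) →
    ∀ g → N ≤ V g → ConnSlimLine ℋ g → UniqueStrictCover (closure ℋ) g
theorem1p4 ℋ ℋ⊆O _ N 7≤N unique g N≤V =
  unique-from ℋ ℋ⊆O (≤-trans (s≤s (s≤s (s≤s z≤n))) 7≤N) unique (≤⇒≤′ N≤V) g refl
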